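{- Let $x^*$ be the unique root of $p(x) = 8x^3 - 22x^2 + 10x - 1$ in $[0,1/6]$, and let $H$ be a 3-uniform hypergraph with $v(H) \geq 5$ and $\delta_2^{\mathrm{ess}}(H) \geq (1 - x^*)\, v(H)$. Then $w_H(O) \geq 0$ for every ordered triple $O=(x_1,x_2,x_3)$ of distinct vertices with $\{x_1,x_2,x_3\}\in E(H)$. In particular, $w_H$ is a perfect fractional Steiner triple system of $H$.
   Context: Let $H$ be a 3-uniform hypergraph, $v(H)=|V(H)|$. For a pair $p$ of vertices, $N(p)=\{v: p\cup\{v\}\in E(H)\}$ and $\deg(p)=|N(p)|$; $\partial H$ is the graph of pairs with $\deg(p)>0$; $\delta_2^{\mathrm{ess}}(H)=\min\{\deg(p): \deg(p)>0\}$. For $\psi\colon E(H)\to\mathbb{R}$, $\deg^\psi(p)=\sum_{e\in E(H),\,p\subseteq e}\psi(e)$; a perfect fractional Steiner triple system of $H$ is a $\psi\colon E(H)\to[0,1]$ with $\deg^\psi(p)=1$ for all $p\in E(\partial H)$. For $r\in\{3,4,5\}$ an $r$-clique is an $r$-set of vertices all of whose 3-subsets are edges; for a vertex set $S$, $\mathcal{K}_r(H,S)$ is the set of $r$-cliques containing $S$. An ordered 5-clique is a 5-tuple $(v_1,\dots,v_5)$ of distinct vertices forming a 5-clique. For an ordered triple $O=(x_1,x_2,x_3)$, $\mathcal{OK}_5(H,O)$ is the set of ordered 5-cliques in which $x_1,x_2,x_3$ occur as a subsequence in this order; for an edge $e$, $\mathcal{OK}_5(H,e)$ is the set of ordered 5-cliques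 whose vertex set contains $e$. For $r\in\{2,3,4\}$, $W(v_1,\dots,v_r)=\prod_{i=2}^{r}1/|\mathcal{K}_{i+1}(H,\{v_1,\dots,v_i\})|$. For an ordered 5-clique $K=(v_1,\dots,v_5)$ and $e\in E(H)$, $\psi_K(e)=1/3$ if $e\subseteq\{v_1,\dots,v_5\}$ and $|e\cap\{v_1,v_2\}|\in\{0,2\}$, $\psi_K(e)=-1/6$ if $e\subseteq\{v_1,\dots,v_5\}$ and $|e\cap\{v_1,v_2\}|=1$, and $0$ otherwise. Define $w_H(e)=\frac12\sum_{K=(v_1,\dots,v_5)\in\mathcal{OK}_5(H,e)}W(v_1,\dots,v_4)\psi_K(e)$ for $e\in E(H)$, and for an ordered triple $O=(x_1,x_2,x_3)$ with $\{x_1,x_2,x_3\}\in E(H)$, $w_H(O)=\frac12\sum_{K=(v_1,\dots,v_5)\in\mathcal{OK}_5(H,O)}W(v_1,\dots,v_4)\psi_K(\{x_1,x_2,x_3\})$ (so $w_H(e)$ is the sum of $w_H(O)$ over the six orderings $O$ of $e$). -}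

module Defs where

open import Data.Nat as ℕ using (ℕ; zero; suc)
open import Data.Fin as Fin using (Fin)
open import Data.Bool using (Bool; true; false; _∧_; _∨_; not; if_then_else_)
open import Data.List using (List; []; _∷_; length; filterᵇ; allFin; foldr; map)
open import Data.Bool.ListAction using (all; any)
open import Data.Product using (_×_)
open import Data.Sum using (_⊎_)
open import Data.Integer using (+_; -[1+_])
open import Data.Rational using (ℚ; 0ℚ; 1ℚ; _+_; _*_; _-_; _≤_; _/_; ½)
open import Relation.Binary.PropositionalEquality using (_≡_; _≢_)
open import Relation.Nullary.Decidable using (⌊_⌋)

record Hypergraph3 (n : ℕ) : Set where
  field
    edge          : Fin n → Fin n → Fin n → Bool
    edge-distinct : ∀ x y z → edge x y z ≡ true → (x ≢ y) × (y ≢ z) × (x ≢ z)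
    edge-sym₁₂    : ∀ x y z → edge x y z ≡ edge y x z
    edge-sym₂₃    : ∀ x y z → edge x y z ≡ edge x z y
open Hypergraph3 public

_==_ : ∀ {n} → Fin n → Fin n → Bool
x == y = ⌊ x Fin.≟ y ⌋

_∈ᵇ_ : ∀ {n} → Fin n → List (Fin n) → Bool
x ∈ᵇ l = any (λ y → x == y) l

count : ∀ {n} → (Fin n → Bool) → ℕ
count {n} P = length (filterᵇ P (allFin n))

Σᵥ : ∀ {n} → (Fin n → ℚ) → ℚ
Σᵥ {n} f = foldr _+_ 0ℚ (map f (allFin n))

-- 1 / k as a rational (with the harmless convention 1/0 = 0; it is
-- only ever applied to positive counts in the definition of w_H)
inv : ℕ → ℚ
inv zero    = 0ℚ
inv (suc k) = + 1 / suc k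

-- d / n as a rational (n ≥ 5 in the theorem, so the n = 0 case is unused)
frac : ℕ → ℕ → ℚ
frac d zero    = 0ℚ
frac d (suc m) = + d / suc m

ℚ[_] : ℕ → ℚ
ℚ[ k ] = + k / 1

deg : ∀ {n} → Hypergraph3 n → Fin n → Fin n → ℕ
deg H a b = count (λ c → edge H a b c)

InShadow : ∀ {n} → Hypergraph3 n → Fin n → Fin n → Set
InShadow H a b = (a ≢ b) × (0 ℕ.< deg H a b)

distinctᵇ : ∀ {n} → List (Fin n) → Bool
distinctᵇ []      = true
distinctᵇ (x ∷ l) = not (x ∈ᵇ l) ∧ distinctᵇ l

isCliqueᵇ : ∀ {n} → Hypergraph3 n → List (Fin n) → Bool
isCliqueᵇ H l =
  all (λ x → all (λ y → all (λ z →
        (x == y ∨ y == z ∨ x == z) ∨ edge H x y z) l) l) l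

-- |K_{|S|+1}(H, S)| for a set S of vertices given as a duplicate-free
-- list: the (|S|+1)-cliques containing S are exactly S ∪ {u} for the
-- vertices u ∉ S such that S ∪ {u} is a clique.
Kcount : ∀ {n} → Hypergraph3 n → List (Fin n) → ℕ
Kcount H S = count (λ u → not (u ∈ᵇ S) ∧ isCliqueᵇ H (u ∷ S))

W₄ : ∀ {n} → Hypergraph3 n → Fin n → Fin n → Fin n → Fin n → ℚ
W₄ H v₁ v₂ v₃ v₄ =
  inv (Kcount H (v₁ ∷ v₂ ∷ []))
  * inv (Kcount H (v₁ ∷ v₂ ∷ v₃ ∷ []))
  * inv (Kcount H (v₁ ∷ v₂ ∷ v₃ ∷ v₄ ∷ []))

isOrd5Cliqueᵇ : ∀ {n} → Hypergraph3 n → Fin n → Fin n → Fin n → Fin n → Fin n → Bool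
isOrd5Cliqueᵇ H v₁ v₂ v₃ v₄ v₅ =
  distinctᵇ (v₁ ∷ v₂ ∷ v₃ ∷ v₄ ∷ v₅ ∷ []) ∧ isCliqueᵇ H (v₁ ∷ v₂ ∷ v₃ ∷ v₄ ∷ v₅ ∷ [])

subseqᵇ : ∀ {n} → List (Fin n) → List (Fin n) → Bool
subseqᵇ []      m       = true
subseqᵇ (x ∷ l) []      = false
subseqᵇ (x ∷ l) (y ∷ m) = if x == y then subseqᵇ l m else subseqᵇ (x ∷ l) m

ψK : ∀ {n} → Fin n → Fin n → Fin n → Fin n → Fin n → Fin n → Fin n → Fin n → ℚ
ψK v₁ v₂ v₃ v₄ v₅ x₁ x₂ x₃ =
  if all (λ x → x ∈ᵇ (v₁ ∷ v₂ ∷ v₃ ∷ v₄ ∷ v₅ ∷ [])) (x₁ ∷ x₂ ∷ x₃ ∷ [])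
  then (if (v₁ ∈ᵇ e) ∧ not (v₂ ∈ᵇ e) ∨ not (v₁ ∈ᵇ e) ∧ (v₂ ∈ᵇ e)
        then -[1+ 0 ] / 6
        else + 1 / 3)
  else 0ℚ
  where e = x₁ ∷ x₂ ∷ x₃ ∷ []

Σ₅ : ∀ {n} → (Fin n → Fin n → Fin n → Fin n → Fin n → ℚ) → ℚ
Σ₅ f = Σᵥ λ v₁ → Σᵥ λ v₂ → Σᵥ λ v₃ → Σᵥ λ v₄ → Σᵥ λ v₅ → f v₁ v₂ v₃ v₄ v₅

wO : ∀ {n} → Hypergraph3 n → Fin n → Fin n → Fin n → ℚ
wO H x₁ x₂ x₃ = ½ * Σ₅ λ v₁ v₂ v₃ v₄ v₅ →
  if isOrd5Cliqueᵇ H v₁ v₂ v₃ v₄ v₅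
     ∧ subseqᵇ (x₁ ∷ x₂ ∷ x₃ ∷ []) (v₁ ∷ v₂ ∷ v₃ ∷ v₄ ∷ v₅ ∷ [])
  then W₄ H v₁ v₂ v₃ v₄ * ψK v₁ v₂ v₃ v₄ v₅ x₁ x₂ x₃
  else 0ℚ

wE : ∀ {n} → Hypergraph3 n → Fin n → Fin n → Fin n → ℚ
wE H a b c = ½ * Σ₅ λ v₁ v₂ v₃ v₄ v₅ →
  if isOrd5Cliqueᵇ H v₁ v₂ v₃ v₄ v₅
     ∧ all (λ x → x ∈ᵇ (v₁ ∷ v₂ ∷ v₃ ∷ v₄ ∷ v₅ ∷ [])) (a ∷ b ∷ c ∷ [])
  then W₄ H v₁ v₂ v₃ v₄ * ψK v₁ v₂ v₃ v₄ v₅ a b c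
  else 0ℚ

-- Perfect fractional Steiner triple systems.
-- ψ is given on triples; only its values on edges matter.
-- deg^ψ({a,b}) = Σ_{e ∈ E(H), {a,b} ⊆ e} ψ(e) = Σ_{c : {a,b,c} ∈ E(H)} ψ(a,b,c).

degψ : ∀ {n} → Hypergraph3 n → (Fin n → Fin n → Fin n → ℚ) → Fin n → Fin n → ℚ
degψ H ψ a b = Σᵥ λ c → if edge H a b c then ψ a b c else 0ℚ

IsPerfectFracSTS : ∀ {n} → Hypergraph3 n → (Fin n → Fin n → Fin n → ℚ) → Set
IsPerfectFracSTS H ψ =
  (∀ a b c → edge H a b c ≡ true → (0ℚ ≤ ψ a b c) × (ψ a b c ≤ 1ℚ))
  × (∀ a b → InShadow H a b → degψ H ψ a b ≡ 1ℚ)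

-- The constant x*: unique root of p(x) = 8x³ − 22x² + 10x − 1 in [0,1/6].
-- There are no reals, so x* is given by its lower Dedekind cut
-- q ≤ x*.  Since p(0) = −1 < 0 < p(1/6) and p' > 0 on [0,1/6]:
--   q ≤ x*  ⇔  q ≤ 0  or  (q ≤ 1/6 and p(q) ≤ 0).

p : ℚ → ℚ
p x = ℚ[ 8 ] * (x * x * x) - ℚ[ 22 ] * (x * x) + ℚ[ 10 ] * x - 1ℚ

_≤x* : ℚ → Set
q ≤x* = (q ≤ 0ℚ) ⊎ ((q ≤ + 1 / 6) × (p q ≤ 0ℚ))

-- δ₂^ess(H) ≥ (1 − x*) v(H):  every pair of positive degree has
-- deg(p) ≥ (1 − x*) n, i.e. 1 − deg(p)/n ≤ x*.
MinEssCodegreeCond : ∀ {n} → Hypergraph3 n → Set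
MinEssCodegreeCond {n} H =
  ∀ a b → InShadow H a b → (1ℚ - frac (deg H a b) n) ≤x*

{-# OPTIONS --safe #-}

-- Write A_ijk for the part of w_H(x₁, x₂, x₃) in which x₁, x₂, x₃ sit at positions i < j < k.
-- Since W is symmetric in v₁ and v₂,
--   6 w_H(O) = A₁₂₃ + (A₁₂₄ − A₁₃₄) + (A₁₂₅ − A₁₃₅) + (A₃₄₅ − A₁₄₅),
-- and the two terms of each difference range over the same free vertices u, v and differ only in
-- one factor: 1/K(x₁x₂) or 1/K(uv) against 1/K(x₁u).  The sum A₁₂₃ telescopes to 1/K(x₁x₂).
-- If every relative deficit 1 − deg/n is at most x, inclusion–exclusion bounds the remaining factors
-- below in terms of the very deficits of x₁x₂ and uv that make the differences negative; the
-- worst case is that both deficits vanish, where the total loss is at most A₁₂₃ provided that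
--   x/(1 − x) · (1/(1 − 2x) + 2/(1 − 4x)) ≤ 1,   that is,   p(x) ≤ 0.
-- For fixed K, the values ψ_K(e) over the edges e through a pair sum to 1 if the pair is
-- {v₁, v₂} and to 0 otherwise, so the degree of every shadow pair telescopes to 1.

module Submission where

open import Defs
open import Data.Nat using (ℕ; _≤_)
open import Data.Fin using (Fin)
open import Data.Product using (_×_)
open import Data.Rational using (0ℚ) renaming (_≤_ to _≤ℚ_)
open import Relation.Binary.PropositionalEquality using (_≡_; _≢_)
open import Data.Bool using (true)

open import Data.Bool using (Bool; false; if_then_else_; _∧_; _∨_; not)
open import Data.Bool.ListAction using (all)
import Data.Bool.Properties as Bool
open import Data.Fin using (zero; suc; #_)
import Data.Fin as Fin
import Data.Fin.Properties as Fin
import Data.Integer as ℤ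
import Data.Integer.Properties as ℤ
open import Data.List using (List; []; _∷_; _∷ʳ_; length; filterᵇ; allFin; foldr; map)
open import Data.List.Properties using (map-tabulate; length-tabulate)
open import Data.List.Membership.Propositional using (_∈_; _∉_)
open import Data.List.Relation.Binary.Permutation.Propositional using (_↭_; prep; swap; ↭-sym; ↭-refl; ↭-trans)
import Data.List.Relation.Binary.Permutation.Propositional as Perm
open import Data.List.Relation.Binary.Permutation.Propositional.Properties using (++-comm; ∷↭∷ʳ)
open import Data.List.Relation.Unary.Any using (here; there)
open import Data.Maybe using (Maybe; just; nothing; maybe)
open import Data.Nat using (zero; suc; s≤s; z≤n)
import Data.Nat as ℕ
import Data.Nat.Properties as ℕ
open import Data.Product using (_,_; ∃; proj₁; proj₂)
open import Data.Rational using (ℚ; 1ℚ; ½; _+_; _*_; _-_; -_; 1/_; _/_; positive; nonNegative; >-nonZero; toℚᵘ) renaming (_<_ to _<ℚ_)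
import Data.Rational.Properties as ℚ
import Data.Rational.Unnormalised as ℚᵘ
import Data.Rational.Unnormalised.Properties as ℚᵘ
open import Data.Sum using (inj₁; inj₂)
open import Data.Vec using (Vec; []; _∷_; lookup)
import Data.Vec as Vec
open import Function using (_∘_; id)
open import Level using (0ℓ)
open import Relation.Binary.PropositionalEquality using (refl; sym; trans; cong; cong₂; subst; subst₂; module ≡-Reasoning)
open import Relation.Nullary using (Dec; yes; no; contradiction)
open import Relation.Nullary.Decidable using (_×-dec_; _→-dec_; True; toWitness; dec⇒maybe)
open import Tactic.RingSolver using (solve-∀)
open import Tactic.RingSolver.Core.AlmostCommutativeRing using (AlmostCommutativeRing; fromCommutativeRing)

-- The loss is controlled clique by clique. The budget 1/K(x₁x₂) is not spread uniformly over the
-- pairs (u, v), but with the weights [v extends S]/K(S) for S = x₁x₂x₃u and S = x₁x₂u, since the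
-- factors 1/K(x₁x₂x₃u) and 1/K(x₁x₂u) remain in the bounds for the losses. Such weights sum to at
-- most 1 over v, whatever the degrees are, and u has at most n choices. The first share pays for
-- A₁₃₄ - A₁₂₄; everything left pays for the other two differences, which have 1/K(x₁x₂uv) in common
-- and are treated together. The obstacle is that raising K(x₁x₂) or K(uv) raises the loss and at
-- the same time the lower bounds for K(x₁x₂u) and K(x₁x₂uv), so no factor can be put to its extreme
-- value in isolation. The polynomial inequalities are therefore proved by explicit certificates:
-- the difference of the two sides is rewritten as a sum of products of nonnegative quantities. As
-- x* is known only through rational approximations from below, an integer bound X for all deficits
-- takes the place of x* n.

ℚ-ring : AlmostCommutativeRing 0ℓ 0ℓ
ℚ-ring = fromCommutativeRing ℚ.+-*-commutativeRing λ x → dec⇒maybe (0ℚ ℚ.≟ x)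

-- Inequalities and reciprocals in the rationals

0≤+ : ∀ {x y} → 0ℚ ≤ℚ x → 0ℚ ≤ℚ y → 0ℚ ≤ℚ x + y
0≤+ = ℚ.+-mono-≤

0≤* : ∀ {x y} → 0ℚ ≤ℚ x → 0ℚ ≤ℚ y → 0ℚ ≤ℚ x * y
0≤* {x} {y} 0≤x 0≤y =
  subst (_≤ℚ x * y) (ℚ.*-zeroʳ x) (ℚ.*-monoˡ-≤-nonNeg x {{nonNegative 0≤x}} 0≤y)

≤⇒0≤- : ∀ {x y} → x ≤ℚ y → 0ℚ ≤ℚ y - x
≤⇒0≤- {x} {y} x≤y = subst (_≤ℚ y - x) (ℚ.+-inverseʳ x) (ℚ.+-monoˡ-≤ (- x) x≤y)

0≤-⇒≤ : ∀ {x y} → 0ℚ ≤ℚ y - x → x ≤ℚ y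
0≤-⇒≤ {x} {y} 0≤y-x =
  subst₂ _≤ℚ_ (ℚ.+-identityˡ x) (cancel y x) (ℚ.+-monoˡ-≤ x 0≤y-x)
  where
  cancel : ∀ y x → (y - x) + x ≡ y
  cancel = solve-∀ ℚ-ring

*-cancel-0≤ : ∀ {x y} → 0ℚ <ℚ x → 0ℚ ≤ℚ x * y → 0ℚ ≤ℚ y
*-cancel-0≤ {x} {y} 0<x 0≤xy =
  ℚ.*-cancelˡ-≤-pos x {{positive 0<x}} (subst (_≤ℚ x * y) (sym (ℚ.*-zeroʳ x)) 0≤xy)

*-monoʳ-0≤ : ∀ {x y m} → 0ℚ ≤ℚ m → x ≤ℚ y → x * m ≤ℚ y * m
*-monoʳ-0≤ {m = m} 0≤m = ℚ.*-monoʳ-≤-nonNeg m {{nonNegative 0≤m}}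

*-monoˡ-0≤ : ∀ {x y m} → 0ℚ ≤ℚ m → x ≤ℚ y → m * x ≤ℚ m * y
*-monoˡ-0≤ {m = m} 0≤m = ℚ.*-monoˡ-≤-nonNeg m {{nonNegative 0≤m}}

-- Treats `inv` of a positive count and the field inverse `1/` alike, and carries the sign needed to
-- multiply inequalities.
record Reciprocal (x i : ℚ) : Set where
  constructor recip
  field
    nonneg  : 0ℚ ≤ℚ i
    inverse : x * i ≡ 1ℚ
open Reciprocal

recip-* : ∀ {x y i j} → Reciprocal x i → Reciprocal y j → Reciprocal (x * y) (i * j)
recip-* {x} {y} {i} {j} rx ry = recip (0≤* (nonneg rx) (nonneg ry))
  (trans (regroup x y i j) (cong₂ _*_ (inverse rx) (inverse ry)))
  where
  regroup : ∀ x y i j → x * y * (i * j) ≡ (x * i) * (y * j)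
  regroup = solve-∀ ℚ-ring

recip-diff : ∀ {x y i j} → Reciprocal x i → Reciprocal y j → i - j ≡ (y - x) * (i * j)
recip-diff {x} {y} {i} {j} rx ry = begin
  i - j                      ≡⟨ cong₂ _-_ (ℚ.*-identityˡ i) (ℚ.*-identityˡ j) ⟨
  1ℚ * i - 1ℚ * j            ≡⟨ cong₂ (λ s t → s * i - t * j) (inverse ry) (inverse rx) ⟨
  y * j * i - x * i * j      ≡⟨ regroup x y i j ⟩
  (y - x) * (i * j)          ∎
  where
  open ≡-Reasoning
  regroup : ∀ x y i j → y * j * i - x * i * j ≡ (y - x) * (i * j)
  regroup = solve-∀ ℚ-ring

-- Multiply by the nonnegative `i * j`. The numerators s and t may have either sign, as differences
-- of degrees do.
cross-divide : ∀ s t {x y i j} → Reciprocal x i → Reciprocal y j → s * x ≤ℚ t * y → s * j ≤ℚ t * i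
cross-divide s t {x} {y} {i} {j} rx ry sx≤ty =
  subst₂ _≤ℚ_
    (trans (regroupˡ s x i j) (trans (cong (s * j *_) (inverse rx)) (ℚ.*-identityʳ _)))
    (trans (regroupʳ t y i j) (trans (cong (t * i *_) (inverse ry)) (ℚ.*-identityʳ _)))
    (*-monoʳ-0≤ (0≤* (nonneg rx) (nonneg ry)) sx≤ty)
  where
  regroupˡ : ∀ s x i j → s * x * (i * j) ≡ s * j * (x * i)
  regroupˡ = solve-∀ ℚ-ring
  regroupʳ : ∀ t y i j → t * y * (i * j) ≡ t * i * (y * j)
  regroupʳ = solve-∀ ℚ-ring

reciprocal : ∀ {x} → 0ℚ <ℚ x → ∃ (Reciprocal x)
reciprocal {x} 0<x = (1/ x) {{>-nonZero 0<x}} , recip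
  (ℚ.<⇒≤ (ℚ.positive⁻¹ _ {{ℚ.1/pos⇒pos x {{positive 0<x}}}}))
  (ℚ.*-inverseʳ x {{>-nonZero 0<x}})

-- The extremal inequalities behind the nonnegativity of w_H(O)

cubic : ℚ → ℚ → ℚ
cubic N X = ((N - X) * (N - (X + X)) - X * N) * (N - (X + X) - (X + X)) - (X + X) * N * (N - (X + X))

-- N is the number of vertices and X a bound for the deficits n − deg of the shadow pairs;
-- 0 ≤ cubic N X says p(X/N) ≤ 0.  With K(S) the number of extensions of the clique S, below
-- D = K(x₁x₂), d₁ = K(x₁u), a = K(x₁x₂u), e = K(uv), b = K(x₁uv) and k = K(x₁x₂uv).
module Extremal
  {N X : ℚ} (0≤X : 0ℚ ≤ℚ X) (6X≤N : X + X + X + X + X + X ≤ℚ N)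
  (0<R : 0ℚ <ℚ N - (X + X))
  (0≤cubic : 0ℚ ≤ℚ cubic N X)
  where

  -- P bounds K of a shadow pair from below, and R bounds K(x₁x₂u) from below when x₁x₂ has full
  -- degree. Out of a budget P R, the four-clique difference uses up X N and C is the remainder. In
  -- these terms `cubic N X` is C (R - 2X) - 2 X N R, which equals -N³ p(X/N).
  P R C : ℚ
  P = N - X
  R = N - (X + X)
  C = P * R - X * N

  0≤N-6X : 0ℚ ≤ℚ N - (X + X + X + X + X + X)
  0≤N-6X = ≤⇒0≤- 6X≤N

  0≤R : 0ℚ ≤ℚ R
  0≤R = ℚ.<⇒≤ 0<R

  0≤P : 0ℚ ≤ℚ P
  0≤P = subst (0ℚ ≤ℚ_) (identity N X) (0≤+ 0≤R 0≤X)
    where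
    identity : ∀ N X → N - (X + X) + X ≡ N - X
    identity = solve-∀ ℚ-ring

  0≤N-3X : 0ℚ ≤ℚ N - (X + X + X)
  0≤N-3X = subst (0ℚ ≤ℚ_) (identity N X) (0≤+ 0≤N-6X (0≤+ 0≤X (0≤+ 0≤X 0≤X)))
    where
    identity : ∀ N X → N - (X + X + X + X + X + X) + (X + (X + X)) ≡ N - (X + X + X)
    identity = solve-∀ ℚ-ring

  0≤N : 0ℚ ≤ℚ N
  0≤N = subst (0ℚ ≤ℚ_) (identity N X) (0≤+ 0≤P 0≤X)
    where
    identity : ∀ N X → N - X + X ≡ N
    identity = solve-∀ ℚ-ring

  -- C - X N = N² - 5 X N + 2 X², where X ≤ N/6 absorbs the negative term. `slope` relies on this
  -- surplus over `0≤C`.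
  0≤C-XN : 0ℚ ≤ℚ C - X * N
  0≤C-XN = subst (0ℚ ≤ℚ_) (identity N X)
    (0≤+ (0≤* 0≤N 0≤N-6X) (0≤* 0≤X (0≤+ 0≤N (0≤+ 0≤X 0≤X))))
    where
    identity : ∀ N X → N * (N - (X + X + X + X + X + X)) + X * (N + (X + X))
      ≡ (N - X) * (N - (X + X)) - X * N - X * N
    identity = solve-∀ ℚ-ring

  0≤C : 0ℚ ≤ℚ C
  0≤C = subst (0ℚ ≤ℚ_) (identity C (X * N)) (0≤+ 0≤C-XN (0≤* 0≤X 0≤N))
    where
    identity : ∀ c y → c - y + y ≡ c
    identity = solve-∀ ℚ-ring

  module Degree {D d₁ a : ℚ} (D≤N : D ≤ℚ N) (P≤D : P ≤ℚ D) (P≤d₁ : P ≤ℚ d₁)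
    (a≥ : D - (X + X) ≤ℚ a) where

    0≤D : 0ℚ ≤ℚ D
    0≤D = ℚ.≤-trans 0≤P P≤D

    0≤a : 0ℚ ≤ℚ a
    0≤a = ℚ.≤-trans (subst (0ℚ ≤ℚ_) (identity N X D) (0≤+ 0≤N-3X (≤⇒0≤- P≤D))) a≥
      where
      identity : ∀ N X D → N - (X + X + X) + (D - (N - X)) ≡ D - (X + X)
      identity = solve-∀ ℚ-ring

    -- Both sides agree in the worst case d₁ = P, D = N, a = R. The certificate measures the
    -- distance from it by d₁ - P, a - (D - 2X) and N - D.
    four-clique-bound : (D - d₁) * P * R ≤ℚ d₁ * a * X
    four-clique-bound = 0≤-⇒≤ (subst (0ℚ ≤ℚ_) (identity N X D d₁ a)
      (0≤+ (0≤* (≤⇒0≤- P≤d₁) (0≤+ (0≤* 0≤a 0≤X) (0≤* 0≤P 0≤R)))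
           (0≤* 0≤P (0≤+ (0≤* (≤⇒0≤- a≥) 0≤X) (0≤* (≤⇒0≤- D≤N) 0≤N-3X)))))
      where
      identity : ∀ N X D d₁ a → let P = N - X ; R = N - (X + X) in
        (d₁ - P) * (a * X + P * R) + P * ((a - (D - (X + X))) * X + (N - D) * (N - (X + X + X)))
          ≡ d₁ * a * X - (D - d₁) * P * R
      identity = solve-∀ ℚ-ring

    four-clique-weight : ∀ {iP iR iD i₁ ia} →
      Reciprocal P iP → Reciprocal R iR → Reciprocal D iD → Reciprocal d₁ i₁ → Reciprocal a ia →
      (i₁ - iD) * ia ≤ℚ iD * (X * (iP * iR))
    four-clique-weight {iP} {iR} {iD} {i₁} {ia} rP rR rD r₁ ra =
      subst (_≤ℚ iD * (X * (iP * iR)))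
        (trans (regroup (D - d₁) i₁ iD ia) (cong (_* ia) (sym (recip-diff r₁ rD))))
        (*-monoˡ-0≤ (nonneg rD) (cross-divide (D - d₁) X (recip-* rP rR) (recip-* r₁ ra)
          (subst₂ _≤ℚ_ (ℚ.*-assoc (D - d₁) P R) (ℚ.*-comm (d₁ * a) X) four-clique-bound)))
      where
      regroup : ∀ s i j k → j * (s * (i * k)) ≡ s * (i * j) * k
      regroup = solve-∀ ℚ-ring

    module Pair {e b k : ℚ} (e≤N : e ≤ℚ N) (P≤e : P ≤ℚ e)
      (b≥ : e - (X + X) ≤ℚ b) (k≥ : a + e - (X + X) - N ≤ℚ k) where

      0≤e : 0ℚ ≤ℚ e
      0≤e = ℚ.≤-trans 0≤P P≤e

      0≤b : 0ℚ ≤ℚ b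
      0≤b = ℚ.≤-trans (subst (0ℚ ≤ℚ_) (identity N X e) (0≤+ 0≤N-3X (≤⇒0≤- P≤e))) b≥
        where
        identity : ∀ N X D → N - (X + X + X) + (D - (N - X)) ≡ D - (X + X)
        identity = solve-∀ ℚ-ring

      -- Since N - e ≤ X, at least X (N R - C) = 2 X² P is left.
      0≤XNR-CZ : 0ℚ ≤ℚ X * N * R - C * (N - e)
      0≤XNR-CZ = subst (0ℚ ≤ℚ_) (identity N X e)
        (0≤+ (0≤* (≤⇒0≤- P≤e) 0≤C) (0≤* (0≤* (0≤+ 0≤X 0≤X) 0≤X) 0≤P))
        where
        identity : ∀ N X e → let P = N - X ; R = N - (X + X) ; C = P * R - X * N in
          (e - P) * C + (X + X) * X * P ≡ X * N * R - C * (N - e)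
        identity = solve-∀ ℚ-ring

      -- The linear term in N − e cancels exactly.
      tangent : 0ℚ ≤ℚ e * b * (X * N * R - C * (N - e)) - N * N * (e - P) * (R * R)
      tangent = subst (0ℚ ≤ℚ_) (identity N X e b)
        (0≤+ (0≤* (0≤* 0≤e (≤⇒0≤- b≥)) 0≤XNR-CZ)
             (0≤* (0≤* 0≤Z 0≤Z) (0≤+ (0≤* 0≤C (0≤+ 0≤N 0≤R)) 0≤XNR-CZ)))
        where
        0≤Z = ≤⇒0≤- e≤N
        identity : ∀ N X e b → let P = N - X ; R = N - (X + X) ; C = P * R - X * N in
          e * (b - (e - (X + X))) * (X * N * R - C * (N - e))
            + (N - e) * (N - e) * (C * (N + R) + (X * N * R - C * (N - e)))
          ≡ e * b * (X * N * R - C * (N - e)) - N * N * (e - P) * (R * R)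
        identity = solve-∀ ℚ-ring

      -- This is the coefficient of a in `normalised-bound` once k is replaced by its lower bound;
      -- its sign allows a to be lowered to D - 2X too. R times it is the expression of `tangent`
      -- plus e b (R (C - X N) + C (N - e)).
      slope : 0ℚ ≤ℚ e * b * C - N * N * (e - P) * R
      slope = *-cancel-0≤ 0<R (subst (0ℚ ≤ℚ_) (identity N R C X e b (e - P))
        (0≤+ tangent (0≤* (0≤* 0≤e 0≤b) (0≤+ (0≤* 0≤R 0≤C-XN) (0≤* 0≤C (≤⇒0≤- e≤N))))))
        where
        identity : ∀ N R C X e b f →
          (e * b * (X * N * R - C * (N - e)) - N * N * f * (R * R))
            + e * b * (R * (C - X * N) + C * (N - e))
          ≡ R * (e * b * C - N * N * f * R)
        identity = solve-∀ ℚ-ring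

      -- First k, then by `slope` also a, is lowered to its bound. Taking out the expression of
      -- `tangent`, which contains all of the first-order dependence on N - e, leaves e b times
      -- `cubic N X` and terms with the factor N - D. Here p(X/N) ≤ 0 enters.
      normalised-bound : 0ℚ ≤ℚ e * b * k * C - ((D - P) * (e * b) + (e - P) * N * a) * N * R
      normalised-bound = subst (0ℚ ≤ℚ_) (identity N X D e a b k)
        (0≤+ (0≤+ (0≤+ (0≤* (0≤* (0≤* 0≤e 0≤b) 0≤C) (≤⇒0≤- k≥)) (0≤* (≤⇒0≤- a≥) slope)) tangent)
             (0≤+ (0≤* (0≤* (0≤* (0≤* 0≤Y 0≤N) 0≤N) (≤⇒0≤- P≤e)) 0≤R)
                  (0≤* (0≤* 0≤e 0≤b) (0≤+ 0≤cubic (0≤* (0≤* 0≤Y (0≤+ 0≤X 0≤X)) 0≤P)))))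
        where
        0≤Y = ≤⇒0≤- D≤N
        identity : ∀ N X D e a b k → let P = N - X ; R = N - (X + X) ; C = P * R - X * N in
          ((e * b * C * (k - (a + e - (X + X) - N))
            + (a - (D - (X + X))) * (e * b * C - N * N * (e - P) * R))
            + (e * b * (X * N * R - C * (N - e)) - N * N * (e - P) * (R * R)))
            + ((N - D) * N * N * (e - P) * R
               + e * b * ((C * (R - (X + X)) - (X + X) * N * R) + (N - D) * (X + X) * P))
          ≡ e * b * k * C - ((D - P) * (e * b) + (e - P) * N * a) * N * R
        identity = solve-∀ ℚ-ring

      -- The left side falls and the right side grows with d₁, so d₁ = P is the worst case. There a
      -- factor P cancels, and replacing D by N in the second summand gives `normalised-bound`.
      five-clique-bound : ((D - d₁) * (e * b) + (e - d₁) * D * a) * N * P * R ≤ℚ d₁ * (e * b) * k * C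
      five-clique-bound = 0≤-⇒≤ (subst (0ℚ ≤ℚ_) (identity N P R C D d₁ e a b k)
        (0≤+ (0≤* (≤⇒0≤- P≤d₁)
                  (0≤+ (0≤* (0≤* (0≤* 0≤e 0≤b) 0≤k) 0≤C)
                       (0≤* (0≤* (0≤* (0≤+ (0≤* 0≤e 0≤b) (0≤* 0≤D 0≤a)) 0≤N) 0≤P) 0≤R)))
             (0≤* 0≤P (0≤+ normalised-bound
                           (0≤* (0≤* (0≤* (0≤* (≤⇒0≤- D≤N) (≤⇒0≤- P≤e)) 0≤a) 0≤N) 0≤R)))))
        where
        0≤k : 0ℚ ≤ℚ k
        0≤k = ℚ.≤-trans (subst (0ℚ ≤ℚ_) (k-identity N X D e a)
          (0≤+ 0≤N-6X (0≤+ (≤⇒0≤- P≤D) (0≤+ (≤⇒0≤- P≤e) (≤⇒0≤- a≥))))) k≥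
          where
          k-identity : ∀ N X D e a → N - (X + X + X + X + X + X)
            + ((D - (N - X)) + ((e - (N - X)) + (a - (D - (X + X))))) ≡ a + e - (X + X) - N
          k-identity = solve-∀ ℚ-ring
        identity : ∀ N P R C D d₁ e a b k →
          (d₁ - P) * (e * b * k * C + (e * b + D * a) * N * P * R)
            + P * ((e * b * k * C - ((D - P) * (e * b) + (e - P) * N * a) * N * R)
                   + (N - D) * (e - P) * a * N * R)
          ≡ d₁ * (e * b) * k * C - ((D - d₁) * (e * b) + (e - d₁) * D * a) * N * P * R
        identity = solve-∀ ℚ-ring

      -- `five-clique-bound` divided by all the counts except that `ia` stays on the right: it is
      -- the normalisation that makes the later sum over v at most 1.
      five-clique-weight : ∀ {iN iP iR iD i₁ ia ie ib ik} →
        Reciprocal N iN → Reciprocal P iP → Reciprocal R iR → Reciprocal D iD →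
        Reciprocal d₁ i₁ → Reciprocal a ia → Reciprocal e ie → Reciprocal b ib → Reciprocal k ik →
        ((i₁ - iD) * ia + (i₁ - ie) * ib) * ik ≤ℚ ia * (iD * (iN * (C * (iP * iR))))
      five-clique-weight {iN} {iP} {iR} {iD} {i₁} {ia} {ie} {ib} {ik} rN rP rR rD r₁ ra re rb rk =
        subst₂ _≤ℚ_ lhs (rhs C ia iD iN (iP * iR))
          (*-monoˡ-0≤ (0≤* (nonneg ra) (nonneg rD))
            (cross-divide ((D - d₁) * (e * b) + (e - d₁) * D * a) C (recip-* rN (recip-* rP rR)) (recip-* (recip-* r₁ (recip-* re rb)) rk)
              (subst₂ _≤ℚ_ (assoc ((D - d₁) * (e * b) + (e - d₁) * D * a) N P R)
                (ℚ.*-comm (d₁ * (e * b) * k) C) five-clique-bound)))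
        where
        assoc : ∀ s x y z → s * x * y * z ≡ s * (x * (y * z))
        assoc = solve-∀ ℚ-ring
        rhs : ∀ C x y z w → x * y * (C * (z * w)) ≡ x * (y * (z * (C * w)))
        rhs = solve-∀ ℚ-ring
        lhs : ia * iD * (((D - d₁) * (e * b) + (e - d₁) * D * a) * (i₁ * (ie * ib) * ik))
          ≡ ((i₁ - iD) * ia + (i₁ - ie) * ib) * ik
        lhs = begin
          ia * iD * (((D - d₁) * (e * b) + (e - d₁) * D * a) * (i₁ * (ie * ib) * ik))
            ≡⟨ regroup (D - d₁) (e - d₁) (e * b) D a i₁ iD ia ie ib ik ⟩
          ((D - d₁) * (i₁ * iD) * ia * (e * b * (ie * ib)) + (e - d₁) * (i₁ * ie) * ib * (D * iD * (a * ia))) * ik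
            ≡⟨ cong (_* ik) (cong₂ (λ x y → (D - d₁) * (i₁ * iD) * ia * x + (e - d₁) * (i₁ * ie) * ib * y)
                 (inverse (recip-* re rb)) (cong₂ _*_ (inverse rD) (inverse ra))) ⟩
          ((D - d₁) * (i₁ * iD) * ia * 1ℚ + (e - d₁) * (i₁ * ie) * ib * 1ℚ) * ik
            ≡⟨ cong (_* ik) (cong₂ _+_ (ℚ.*-identityʳ ((D - d₁) * (i₁ * iD) * ia)) (ℚ.*-identityʳ ((e - d₁) * (i₁ * ie) * ib))) ⟩
          ((D - d₁) * (i₁ * iD) * ia + (e - d₁) * (i₁ * ie) * ib) * ik
            ≡⟨ cong (_* ik) (cong₂ (λ x y → x * ia + y * ib) (sym (recip-diff r₁ rD)) (sym (recip-diff r₁ re))) ⟩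
          ((i₁ - iD) * ia + (i₁ - ie) * ib) * ik ∎
          where
          open ≡-Reasoning
          regroup : ∀ s t f D a i₁ iD ia ie ib ik →
            ia * iD * ((s * f + t * D * a) * (i₁ * (ie * ib) * ik))
            ≡ (s * (i₁ * iD) * ia * (f * (ie * ib)) + t * (i₁ * ie) * ib * (D * iD * (a * ia))) * ik
          regroup = solve-∀ ℚ-ring

-- Indicators of booleans

𝟙 : Bool → ℚ
𝟙 b = if b then 1ℚ else 0ℚ

𝟙-∧ : ∀ b c → 𝟙 (b ∧ c) ≡ 𝟙 b * 𝟙 c
𝟙-∧ false c = sym (ℚ.*-zeroˡ (𝟙 c))
𝟙-∧ true  c = sym (ℚ.*-identityˡ (𝟙 c))

if≡𝟙* : ∀ b x → (if b then x else 0ℚ) ≡ 𝟙 b * x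
if≡𝟙* false x = sym (ℚ.*-zeroˡ x)
if≡𝟙* true  x = sym (ℚ.*-identityˡ x)

0≤1 : 0ℚ ≤ℚ 1ℚ
0≤1 = ℚ.nonNegative⁻¹ 1ℚ

0≤𝟙 : ∀ b → 0ℚ ≤ℚ 𝟙 b
0≤𝟙 false = ℚ.≤-refl
0≤𝟙 true  = 0≤1

==-yes : ∀ {n} {x y : Fin n} → x ≡ y → (x == y) ≡ true
==-yes {x = x} {y} x≡y with x Fin.≟ y
... | yes _   = refl
... | no  x≢y = contradiction x≡y x≢y

==-no : ∀ {n} {x y : Fin n} → x ≢ y → (x == y) ≡ false
==-no {x = x} {y} x≢y with x Fin.≟ y
... | yes x≡y = contradiction x≡y x≢y
... | no  _   = refl

==-sym : ∀ {n} (x y : Fin n) → (x == y) ≡ (y == x)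
==-sym x y with x Fin.≟ y
... | yes x≡y = sym (==-yes (sym x≡y))
... | no  x≢y = sym (==-no (x≢y ∘ sym))

-- Finite sums

sumList : ∀ {A : Set} → (A → ℚ) → List A → ℚ
sumList f l = foldr _+_ 0ℚ (map f l)

sumList-cong : ∀ {A : Set} {f g : A → ℚ} (l : List A) → (∀ v → f v ≡ g v) → sumList f l ≡ sumList g l
sumList-cong []      eq = refl
sumList-cong (x ∷ l) eq = cong₂ _+_ (eq x) (sumList-cong l eq)

sumList-mono : ∀ {A : Set} {f g : A → ℚ} (l : List A) → (∀ v → f v ≤ℚ g v) → sumList f l ≤ℚ sumList g l
sumList-mono []      le = ℚ.≤-refl
sumList-mono (x ∷ l) le = ℚ.+-mono-≤ (le x) (sumList-mono l le)

sumList-+ : ∀ {A : Set} (f g : A → ℚ) (l : List A) →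
  sumList (λ v → f v + g v) l ≡ sumList f l + sumList g l
sumList-+ f g []      = refl
sumList-+ f g (x ∷ l) = trans (cong ((f x + g x) +_) (sumList-+ f g l))
  (interchange (f x) (g x) (sumList f l) (sumList g l))
  where
  interchange : ∀ a b c d → a + b + (c + d) ≡ a + c + (b + d)
  interchange = solve-∀ ℚ-ring

sumList-*ˡ : ∀ {A : Set} c (f : A → ℚ) (l : List A) → sumList (λ v → c * f v) l ≡ c * sumList f l
sumList-*ˡ c f []      = sym (ℚ.*-zeroʳ c)
sumList-*ˡ c f (x ∷ l) =
  trans (cong ((c * f x) +_) (sumList-*ˡ c f l)) (sym (ℚ.*-distribˡ-+ c (f x) (sumList f l)))

sumList-zero : ∀ {A : Set} (l : List A) → sumList (λ _ → 0ℚ) l ≡ 0ℚ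
sumList-zero []      = refl
sumList-zero (x ∷ l) = trans (ℚ.+-identityˡ (sumList (λ _ → 0ℚ) l)) (sumList-zero l)

sumList-swap : ∀ {A B : Set} (f : A → B → ℚ) (l : List A) (m : List B) →
  sumList (λ v → sumList (f v) m) l ≡ sumList (λ w → sumList (λ v → f v w) l) m
sumList-swap f []      m = sym (sumList-zero m)
sumList-swap f (x ∷ l) m = trans (cong (sumList (f x) m +_) (sumList-swap f l m))
  (sym (sumList-+ (f x) (λ w → sumList (λ v → f v w) l) m))

Σ-cong : ∀ {n} {f g : Fin n → ℚ} → (∀ v → f v ≡ g v) → Σᵥ f ≡ Σᵥ g
Σ-cong {n} = sumList-cong (allFin n)

Σ-mono : ∀ {n} {f g : Fin n → ℚ} → (∀ v → f v ≤ℚ g v) → Σᵥ f ≤ℚ Σᵥ g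
Σ-mono {n} = sumList-mono (allFin n)

Σ-+ : ∀ {n} (f g : Fin n → ℚ) → Σᵥ (λ v → f v + g v) ≡ Σᵥ f + Σᵥ g
Σ-+ {n} f g = sumList-+ f g (allFin n)

Σ-*ˡ : ∀ {n} c (f : Fin n → ℚ) → Σᵥ (λ v → c * f v) ≡ c * Σᵥ f
Σ-*ˡ {n} c f = sumList-*ˡ c f (allFin n)

Σ-*ʳ : ∀ {n} c (f : Fin n → ℚ) → Σᵥ (λ v → f v * c) ≡ Σᵥ f * c
Σ-*ʳ c f = trans (Σ-cong (λ v → ℚ.*-comm (f v) c)) (trans (Σ-*ˡ c f) (ℚ.*-comm c (Σᵥ f)))

Σ-zero : ∀ {n} {f : Fin n → ℚ} → (∀ v → f v ≡ 0ℚ) → Σᵥ f ≡ 0ℚ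
Σ-zero {n} f≡0 = trans (Σ-cong f≡0) (sumList-zero (allFin n))

Σ-swap : ∀ {m n} (f : Fin m → Fin n → ℚ) → Σᵥ (λ v → Σᵥ (f v)) ≡ Σᵥ (λ w → Σᵥ (λ v → f v w))
Σ-swap {m} {n} f = sumList-swap f (allFin m) (allFin n)

Σ-suc : ∀ {n} (f : Fin (suc n) → ℚ) → Σᵥ f ≡ f Fin.zero + Σᵥ (f ∘ Fin.suc)
Σ-suc f = cong (λ l → f Fin.zero + foldr _+_ 0ℚ l)
  (trans (map-tabulate Fin.suc f) (sym (map-tabulate id (f ∘ Fin.suc))))

Σ-select : ∀ {n} (x : Fin n) (f : Fin n → ℚ) → Σᵥ (λ v → 𝟙 (x == v) * f v) ≡ f x
Σ-select {suc n} Fin.zero f = begin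
  Σᵥ (λ v → 𝟙 (Fin.zero == v) * f v)
    ≡⟨ Σ-suc (λ v → 𝟙 (Fin.zero == v) * f v) ⟩
  1ℚ * f Fin.zero + Σᵥ (λ v → 0ℚ * f (Fin.suc v))
    ≡⟨ cong₂ _+_ (ℚ.*-identityˡ (f Fin.zero)) (Σ-zero λ v → ℚ.*-zeroˡ (f (Fin.suc v))) ⟩
  f Fin.zero + 0ℚ
    ≡⟨ ℚ.+-identityʳ (f Fin.zero) ⟩
  f Fin.zero ∎
  where open ≡-Reasoning
Σ-select {suc n} (Fin.suc x) f = begin
  Σᵥ (λ v → 𝟙 (Fin.suc x == v) * f v)
    ≡⟨ Σ-suc (λ v → 𝟙 (Fin.suc x == v) * f v) ⟩
  0ℚ * f Fin.zero + Σᵥ (λ v → 𝟙 (Fin.suc x == Fin.suc v) * f (Fin.suc v))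
    ≡⟨ cong₂ _+_ (ℚ.*-zeroˡ (f Fin.zero)) (Σ-cong λ v → cong (λ b → 𝟙 b * f (Fin.suc v)) (suc-== v)) ⟩
  0ℚ + Σᵥ (λ v → 𝟙 (x == v) * f (Fin.suc v))
    ≡⟨ ℚ.+-identityˡ (Σᵥ (λ v → 𝟙 (x == v) * f (Fin.suc v))) ⟩
  Σᵥ (λ v → 𝟙 (x == v) * f (Fin.suc v))
    ≡⟨ Σ-select x (f ∘ Fin.suc) ⟩
  f (Fin.suc x) ∎
  where
  open ≡-Reasoning
  suc-== : ∀ v → (Fin.suc x == Fin.suc v) ≡ (x == v)
  suc-== v with x Fin.≟ v
  ... | yes _ = refl
  ... | no  _ = refl

Σ-term-≤ : ∀ {n} (f : Fin n → ℚ) → (∀ v → 0ℚ ≤ℚ f v) → ∀ x → f x ≤ℚ Σᵥ f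
Σ-term-≤ f 0≤f x = subst (_≤ℚ Σᵥ f) (Σ-select x f) (Σ-mono (λ v → term (x == v) (f v) (0≤f v)))
  where
  term : ∀ b y → 0ℚ ≤ℚ y → 𝟙 b * y ≤ℚ y
  term false y 0≤y = subst (_≤ℚ y) (sym (ℚ.*-zeroˡ y)) 0≤y
  term true  y 0≤y = ℚ.≤-reflexive (ℚ.*-identityˡ y)

-- Natural numbers as rationals

toℚᵘ-/ : ∀ i d → toℚᵘ (i / suc d) ℚᵘ.≃ ℚᵘ.mkℚᵘ i d
toℚᵘ-/ i d = ℚ.toℚᵘ-fromℚᵘ (ℚᵘ.mkℚᵘ i d)

ℚ-+ : ∀ m n → ℚ[ m ℕ.+ n ] ≡ ℚ[ m ] + ℚ[ n ]
ℚ-+ m n = ℚ.toℚᵘ-injective (ℚᵘ.≃-trans (toℚᵘ-/ (ℤ.+ (m ℕ.+ n)) 0) (ℚᵘ.≃-sym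
  (ℚᵘ.≃-trans (ℚ.toℚᵘ-homo-+ ℚ[ m ] ℚ[ n ])
  (ℚᵘ.≃-trans (ℚᵘ.+-cong (toℚᵘ-/ (ℤ.+ m) 0) (toℚᵘ-/ (ℤ.+ n) 0))
    (ℚᵘ.*≡* (cong (ℤ._* ℤ.+ 1) (cong₂ ℤ._+_ (ℤ.*-identityʳ (ℤ.+ m)) (ℤ.*-identityʳ (ℤ.+ n)))))))))

ℚ-mono : ∀ {m n} → m ℕ.≤ n → ℚ[ m ] ≤ℚ ℚ[ n ]
ℚ-mono {m} {n} m≤n = ℚ.toℚᵘ-cancel-≤
  (ℚᵘ.≤-respˡ-≃ (ℚᵘ.≃-sym (toℚᵘ-/ (ℤ.+ m) 0)) (ℚᵘ.≤-respʳ-≃ (ℚᵘ.≃-sym (toℚᵘ-/ (ℤ.+ n) 0))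
    (ℚᵘ.*≤* (ℤ.*-monoʳ-≤-nonNeg (ℤ.+ 1) (ℤ.+≤+ m≤n)))))

0≤ℚ[_] : ∀ m → 0ℚ ≤ℚ ℚ[ m ]
0≤ℚ[ m ] = ℚ-mono {0} {m} z≤n

0<ℚ[_] : ∀ {m} → 0 ℕ.< m → 0ℚ <ℚ ℚ[ m ]
0<ℚ[ 0<m ] = ℚ.<-≤-trans (ℚ.positive⁻¹ 1ℚ) (ℚ-mono 0<m)

ℚ-cancel-< : ∀ {m n} → ℚ[ m ] <ℚ ℚ[ n ] → m ℕ.< n
ℚ-cancel-< {m} {n} lt = ℕ.≰⇒> λ n≤m → ℚ.<-irrefl refl (ℚ.<-≤-trans lt (ℚ-mono n≤m))

ℚ*frac : ∀ d {n} → 0 ℕ.< n → ℚ[ n ] * frac d n ≡ ℚ[ d ]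
ℚ*frac d {suc m} _ = ℚ.toℚᵘ-injective
  (ℚᵘ.≃-trans (ℚ.toℚᵘ-homo-* ℚ[ suc m ] (ℤ.+ d / suc m))
  (ℚᵘ.≃-trans (ℚᵘ.*-cong (toℚᵘ-/ (ℤ.+ suc m) 0) (toℚᵘ-/ (ℤ.+ d) m))
  (ℚᵘ.≃-trans (ℚᵘ.*≡* cross) (ℚᵘ.≃-sym (toℚᵘ-/ (ℤ.+ d) 0)))))
  where
  cross : ℤ.+ suc m ℤ.* ℤ.+ d ℤ.* ℤ.+ 1 ≡ ℤ.+ d ℤ.* (ℤ.+ 1 ℤ.* ℤ.+ suc m)
  cross = trans (ℤ.*-identityʳ (ℤ.+ suc m ℤ.* ℤ.+ d))
    (trans (ℤ.*-comm (ℤ.+ suc m) (ℤ.+ d)) (cong (ℤ.+ d ℤ.*_) (sym (ℤ.*-identityˡ (ℤ.+ suc m)))))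

inv-recip : ∀ {m} → 0 ℕ.< m → Reciprocal ℚ[ m ] (inv m)
inv-recip {suc m} _ = recip (ℚ.nonNegative⁻¹ (ℤ.+ 1 / suc m) {{ℚ.normalize-nonNeg 1 (suc m)}}) (ℚ*frac 1 {suc m} (s≤s z≤n))

0≤inv : ∀ m → 0ℚ ≤ℚ inv m
0≤inv zero    = ℚ.≤-refl
0≤inv (suc m) = Reciprocal.nonneg (inv-recip {suc m} (s≤s z≤n))

ℚ*inv≤1 : ∀ m → ℚ[ m ] * inv m ≤ℚ 1ℚ
ℚ*inv≤1 zero    = 0≤1
ℚ*inv≤1 (suc m) = ℚ.≤-reflexive (Reciprocal.inverse (inv-recip {suc m} (s≤s z≤n)))

-- Counting

Σ-count : ∀ {n} (P : Fin n → Bool) → Σᵥ (λ v → 𝟙 (P v)) ≡ ℚ[ count P ]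
Σ-count {n} P = go (allFin n)
  where
  go : ∀ l → sumList (𝟙 ∘ P) l ≡ ℚ[ length (filterᵇ P l) ]
  go []      = refl
  go (x ∷ l) with P x
  ... | true  = trans (cong (1ℚ +_) (go l)) (sym (ℚ-+ 1 (length (filterᵇ P l))))
  ... | false = trans (ℚ.+-identityˡ (sumList (𝟙 ∘ P) l)) (go l)

length-allFin : ∀ n → length (allFin n) ≡ n
length-allFin n = length-tabulate {n = n} id

Σ-const : ∀ n c → Σᵥ {n} (λ _ → c) ≡ ℚ[ n ] * c
Σ-const n c = trans (go (allFin n)) (cong (λ m → ℚ[ m ] * c) (length-allFin n))
  where
  go : ∀ (l : List (Fin n)) → sumList (λ _ → c) l ≡ ℚ[ length l ] * c
  go []      = sym (ℚ.*-zeroˡ c)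
  go (x ∷ l) = trans (cong (c +_) (go l))
    (trans (factor c ℚ[ length l ]) (cong (_* c) (sym (ℚ-+ 1 (length l)))))
    where
    factor : ∀ c k → c + k * c ≡ (1ℚ + k) * c
    factor = solve-∀ ℚ-ring

count-cong : ∀ {n} {P Q : Fin n → Bool} → (∀ v → P v ≡ Q v) → count P ≡ count Q
count-cong {n} {P} {Q} eq = go (allFin n)
  where
  go : ∀ l → length (filterᵇ P l) ≡ length (filterᵇ Q l)
  go []      = refl
  go (x ∷ l) with P x | Q x | eq x
  ... | true  | .true  | refl = cong ℕ.suc (go l)
  ... | false | .false | refl = go l

count-≤ : ∀ {n} (P : Fin n → Bool) → count P ℕ.≤ n
count-≤ {n} P = subst (count P ℕ.≤_) (length-allFin n) (go (allFin n))
  where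
  go : ∀ l → length (filterᵇ P l) ℕ.≤ length l
  go []      = z≤n
  go (x ∷ l) with P x
  ... | true  = s≤s (go l)
  ... | false = ℕ.m≤n⇒m≤1+n (go l)

count-witness : ∀ {n} (P : Fin n → Bool) x → P x ≡ true → 0ℚ <ℚ ℚ[ count P ]
count-witness P x Px = ℚ.<-≤-trans (ℚ.positive⁻¹ 1ℚ)
  (subst₂ _≤ℚ_ (cong 𝟙 Px) (Σ-count P) (Σ-term-≤ (𝟙 ∘ P) (0≤𝟙 ∘ P) x))

-- The sum over all vertices of the pointwise inequality [P] + [Q] - 1 ≤ [P and Q].
count-∧ : ∀ {n} (P Q : Fin n → Bool) →
  ℚ[ count P ] + ℚ[ count Q ] - ℚ[ n ] ≤ℚ ℚ[ count (λ v → P v ∧ Q v) ]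
count-∧ {n} P Q = subst₂ _≤ℚ_ sums (Σ-count (λ v → P v ∧ Q v)) (Σ-mono (λ v → pointwise (P v) (Q v)))
  where
  pointwise : ∀ b c → 𝟙 b + 𝟙 c + - 1ℚ ≤ℚ 𝟙 (b ∧ c)
  pointwise false false = ℚ.nonPositive⁻¹ (- 1ℚ)
  pointwise false true  = ℚ.≤-refl
  pointwise true  false = ℚ.≤-refl
  pointwise true  true  = ℚ.≤-refl
  negate : ∀ n → n * - 1ℚ ≡ - n
  negate = solve-∀ ℚ-ring
  sums : Σᵥ (λ v → 𝟙 (P v) + 𝟙 (Q v) + - 1ℚ) ≡ ℚ[ count P ] + ℚ[ count Q ] - ℚ[ n ]
  sums = trans (Σ-+ (λ v → 𝟙 (P v) + 𝟙 (Q v)) (λ _ → - 1ℚ))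
    (cong₂ _+_ (trans (Σ-+ (𝟙 ∘ P) (𝟙 ∘ Q)) (cong₂ _+_ (Σ-count P) (Σ-count Q)))
               (trans (Σ-const n (- 1ℚ)) (negate ℚ[ n ])))

-- Cliques and their extensions

∧-true⁻ : ∀ {b c} → b ∧ c ≡ true → b ≡ true × c ≡ true
∧-true⁻ {true} {true} _ = refl , refl

∧-true⁺ : ∀ {b c} → b ≡ true → c ≡ true → b ∧ c ≡ true
∧-true⁺ refl refl = refl

bool-ext : ∀ {b c} → (b ≡ true → c ≡ true) → (c ≡ true → b ≡ true) → b ≡ c
bool-ext {false} {false} f g = refl
bool-ext {false} {true}  f g = g refl
bool-ext {true}  {c}     f g = sym (f refl)

all-sound : ∀ {A : Set} (p : A → Bool) l → all p l ≡ true → ∀ {x} → x ∈ l → p x ≡ true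
all-sound p (y ∷ l) h (here refl) = proj₁ (∧-true⁻ {p y} h)
all-sound p (y ∷ l) h (there x∈l) = all-sound p l (proj₂ (∧-true⁻ {p y} h)) x∈l

all-complete : ∀ {A : Set} (p : A → Bool) l → (∀ {x} → x ∈ l → p x ≡ true) → all p l ≡ true
all-complete p []      h = refl
all-complete p (x ∷ l) h = ∧-true⁺ (h (here refl)) (all-complete p l (h ∘ there))

all-cong : ∀ {A : Set} {p q : A → Bool} l → (∀ x → p x ≡ q x) → all p l ≡ all q l
all-cong []      h = refl
all-cong (x ∷ l) h = cong₂ _∧_ (h x) (all-cong l h)

all-↭ : ∀ {A : Set} (p : A → Bool) {l m} → l ↭ m → all p l ≡ all p m
all-↭ p Perm.refl          = refl
all-↭ p (prep x l↭m)       = cong (p x ∧_) (all-↭ p l↭m)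
all-↭ p (swap x y l↭m)     = trans (cong (λ b → p x ∧ (p y ∧ b)) (all-↭ p l↭m)) (exchange (p x) (p y) _)
  where
  exchange : ∀ a b c → a ∧ (b ∧ c) ≡ b ∧ (a ∧ c)
  exchange false b c = sym (Bool.∧-zeroʳ b)
  exchange true  b c = refl
all-↭ p (Perm.trans lm mk) = trans (all-↭ p lm) (all-↭ p mk)

module _ {n : ℕ} where

  ∈ᵇ-↭ : ∀ (x : Fin n) {l m} → l ↭ m → (x ∈ᵇ l) ≡ (x ∈ᵇ m)
  ∈ᵇ-↭ x Perm.refl          = refl
  ∈ᵇ-↭ x (prep y l↭m)       = cong ((x == y) ∨_) (∈ᵇ-↭ x l↭m)
  ∈ᵇ-↭ x (swap y z l↭m)     = trans (cong (λ b → (x == y) ∨ ((x == z) ∨ b)) (∈ᵇ-↭ x l↭m)) (exchange (x == y) (x == z) _)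
    where
    exchange : ∀ a b c → a ∨ (b ∨ c) ≡ b ∨ (a ∨ c)
    exchange false b     c = refl
    exchange true  false c = refl
    exchange true  true  c = refl
  ∈ᵇ-↭ x (Perm.trans lm mk) = trans (∈ᵇ-↭ x lm) (∈ᵇ-↭ x mk)

  distinct-↭ : ∀ {l m : List (Fin n)} → l ↭ m → distinctᵇ l ≡ distinctᵇ m
  distinct-↭ Perm.refl          = refl
  distinct-↭ (prep x l↭m)       = cong₂ (λ b c → not b ∧ c) (∈ᵇ-↭ x l↭m) (distinct-↭ l↭m)
  distinct-↭ (swap {l} {m} x y l↭m) rewrite ==-sym x y | ∈ᵇ-↭ x l↭m | ∈ᵇ-↭ y l↭m | distinct-↭ l↭m =
    exchange (y == x) (x ∈ᵇ m) (y ∈ᵇ m) (distinctᵇ m)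
    where
    exchange : ∀ a b c d → not (a ∨ b) ∧ (not c ∧ d) ≡ not (a ∨ c) ∧ (not b ∧ d)
    exchange true  b     c     d = refl
    exchange false true  true  d = refl
    exchange false true  false d = refl
    exchange false false true  d = refl
    exchange false false false d = refl
  distinct-↭ (Perm.trans lm mk) = trans (distinct-↭ lm) (distinct-↭ mk)

  ∈ᵇ-complete : ∀ {x : Fin n} {l} → x ∈ l → (x ∈ᵇ l) ≡ true
  ∈ᵇ-complete {x} {y ∷ l} (here x≡y) = cong (_∨ (x ∈ᵇ l)) (==-yes x≡y)
  ∈ᵇ-complete {x} {y ∷ l} (there x∈l) with x == y
  ... | true  = refl
  ... | false = ∈ᵇ-complete x∈l

  ∈ᵇ-sound : ∀ {x : Fin n} l → (x ∈ᵇ l) ≡ true → x ∈ l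
  ∈ᵇ-sound {x} (y ∷ l) h with x Fin.≟ y
  ... | yes x≡y = here x≡y
  ... | no  _   = there (∈ᵇ-sound l h)

  not∈ᵇ⇒∉ : ∀ {x : Fin n} {l} → not (x ∈ᵇ l) ≡ true → x ∉ l
  not∈ᵇ⇒∉ h x∈l = contradiction (trans (sym h) (cong not (∈ᵇ-complete x∈l))) λ ()

  ∉⇒not∈ᵇ : ∀ {x : Fin n} {l} → x ∉ l → not (x ∈ᵇ l) ≡ true
  ∉⇒not∈ᵇ {x} {l} x∉l with x ∈ᵇ l in eq
  ... | true  = contradiction (∈ᵇ-sound l eq) x∉l
  ... | false = refl

  count-mono : ∀ {P Q : Fin n → Bool} → (∀ v → P v ≡ true → Q v ≡ true) → ℚ[ count P ] ≤ℚ ℚ[ count Q ]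
  count-mono {P} {Q} h = subst₂ _≤ℚ_ (Σ-count P) (Σ-count Q) (Σ-mono λ v → 𝟙-mono (P v) (Q v) (h v))
    where
    𝟙-mono : ∀ b c → (b ≡ true → c ≡ true) → 𝟙 b ≤ℚ 𝟙 c
    𝟙-mono false c h = 0≤𝟙 c
    𝟙-mono true  c h = ℚ.≤-reflexive (cong 𝟙 (sym (h refl)))

module Cliques {n : ℕ} (H : Hypergraph3 n) where

  edge-swap₁₂ : ∀ {x y z} → edge H x y z ≡ true → edge H y x z ≡ true
  edge-swap₁₂ {x} {y} {z} e = trans (sym (edge-sym₁₂ H x y z)) e

  edge-swap₂₃ : ∀ {x y z} → edge H x y z ≡ true → edge H x z y ≡ true
  edge-swap₂₃ {x} {y} {z} e = trans (sym (edge-sym₂₃ H x y z)) e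

  Clique : List (Fin n) → Set
  Clique l = ∀ {x y z} → x ∈ l → y ∈ l → z ∈ l → x ≢ y → y ≢ z → x ≢ z → edge H x y z ≡ true

  triple : Fin n → Fin n → Fin n → Bool
  triple x y z = (x == y ∨ y == z ∨ x == z) ∨ edge H x y z

  isClique-sound : ∀ l → isCliqueᵇ H l ≡ true → Clique l
  isClique-sound l h {x} {y} {z} x∈ y∈ z∈ x≢y y≢z x≢z =
    subst (λ b → b ∨ edge H x y z ≡ true)
      (cong₂ _∨_ (==-no x≢y) (cong₂ _∨_ (==-no y≢z) (==-no x≢z)))
      (all-sound (triple x y) l
        (all-sound (λ y → all (triple x y) l) l
          (all-sound (λ x → all (λ y → all (triple x y) l) l) l h x∈) y∈) z∈)

  isClique-complete : ∀ l → Clique l → isCliqueᵇ H l ≡ true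
  isClique-complete l c = all-complete _ l λ x∈ → all-complete _ l λ y∈ → all-complete _ l λ z∈ → ok x∈ y∈ z∈
    where
    ok : ∀ {x y z} → x ∈ l → y ∈ l → z ∈ l → triple x y z ≡ true
    ok {x} {y} {z} x∈ y∈ z∈ with x Fin.≟ y | y Fin.≟ z | x Fin.≟ z
    ... | yes _   | _       | _       = refl
    ... | no _    | yes _   | _       = refl
    ... | no _    | no _    | yes _   = refl
    ... | no x≢y  | no y≢z  | no x≢z  = c x∈ y∈ z∈ x≢y y≢z x≢z

  Clique-∷ : ∀ {u l} → Clique l → (∀ {x y} → x ∈ l → y ∈ l → x ≢ y → edge H x y u ≡ true) → Clique (u ∷ l)
  Clique-∷ c j (here refl) (here refl) _           x≢y _   _   = contradiction refl x≢y
  Clique-∷ c j (here refl) (there _)   (here refl) _   _   x≢z = contradiction refl x≢z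
  Clique-∷ c j (here refl) (there y∈)  (there z∈)  _   y≢z _   = edge-swap₁₂ (edge-swap₂₃ (j y∈ z∈ y≢z))
  Clique-∷ c j (there _)   (here refl) (here refl) _   y≢z _   = contradiction refl y≢z
  Clique-∷ c j (there x∈)  (here refl) (there z∈)  _   _   x≢z = edge-swap₂₃ (j x∈ z∈ x≢z)
  Clique-∷ c j (there x∈)  (there y∈)  (here refl) x≢y _   _   = j x∈ y∈ x≢y
  Clique-∷ c j (there x∈)  (there y∈)  (there z∈)  x≢y y≢z x≢z = c x∈ y∈ z∈ x≢y y≢z x≢z

  Clique-pair : ∀ a b → Clique (a ∷ b ∷ [])
  Clique-pair a b = Clique-∷ (Clique-∷ {b} {[]} (λ ()) (λ ()))
    λ { (here refl) (here refl) x≢y → contradiction refl x≢y }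

  isClique-↭ : ∀ {l m} → l ↭ m → isCliqueᵇ H l ≡ isCliqueᵇ H m
  isClique-↭ {l} {m} l↭m =
    trans (all-↭ (λ x → all (λ y → all (triple x y) l) l) l↭m)
      (all-cong m λ x → trans (all-↭ (λ y → all (triple x y) l) l↭m)
        (all-cong m λ y → all-↭ (triple x y) l↭m))

  opaque

    -- Kept opaque so that clique tests on explicit lists do not unfold into large boolean terms.
    -- `isOrd5Clique≡cliqueᵇ` and `Kcount≡count`, which are definitional inside the block, link the
    -- two tests to the definition of w_H.
    extends : List (Fin n) → Fin n → Bool
    extends S u = not (u ∈ᵇ S) ∧ isCliqueᵇ H (u ∷ S)

    cliqueᵇ : List (Fin n) → Bool
    cliqueᵇ l = distinctᵇ l ∧ isCliqueᵇ H l

    clique-↭ : ∀ {l m} → l ↭ m → cliqueᵇ l ≡ cliqueᵇ m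
    clique-↭ l↭m = cong₂ _∧_ (distinct-↭ l↭m) (isClique-↭ l↭m)

    clique-∷ : ∀ u S → cliqueᵇ (u ∷ S) ≡ cliqueᵇ S ∧ extends S u
    clique-∷ u S = regroup (not (u ∈ᵇ S)) (distinctᵇ S) (isCliqueᵇ H S) (isCliqueᵇ H (u ∷ S)) tail
      where
      tail : isCliqueᵇ H (u ∷ S) ≡ true → isCliqueᵇ H S ≡ true
      tail h = isClique-complete S λ x∈ y∈ z∈ →
        isClique-sound (u ∷ S) h (there x∈) (there y∈) (there z∈)
      regroup : ∀ a b c d → (d ≡ true → c ≡ true) → (a ∧ b) ∧ d ≡ (b ∧ c) ∧ (a ∧ d)
      regroup false false c     d     h = refl
      regroup false true  c     d     h = sym (Bool.∧-zeroʳ c)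
      regroup true  false c     d     h = refl
      regroup true  true  true  d     h = refl
      regroup true  true  false false h = refl
      regroup true  true  false true  h = sym (h refl)

    extends-sound : ∀ {S u} → extends S u ≡ true → u ∉ S × Clique (u ∷ S)
    extends-sound {S} {u} h =
      not∈ᵇ⇒∉ (proj₁ (∧-true⁻ {not (u ∈ᵇ S)} h)) ,
      isClique-sound (u ∷ S) (proj₂ (∧-true⁻ {not (u ∈ᵇ S)} h))

    clique-sound : ∀ {S} → cliqueᵇ S ≡ true → Clique S
    clique-sound {S} h = isClique-sound S (proj₂ (∧-true⁻ {distinctᵇ S} h))

    edge⇒extends : ∀ a b w → edge H a b w ≡ true → extends (a ∷ b ∷ []) w ≡ true
    edge⇒extends a b w e = ∧-true⁺
      (∉⇒not∈ᵇ {x = w} {a ∷ b ∷ []} λ { (here refl)         → proj₂ (proj₂ (edge-distinct H _ _ _ e)) refl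
       ; (there (here refl)) → proj₁ (proj₂ (edge-distinct H _ _ _ e)) refl })
      (isClique-complete _ (Clique-∷ (Clique-pair a b) join))
      where
      join : ∀ {x y} → x ∈ a ∷ b ∷ [] → y ∈ a ∷ b ∷ [] → x ≢ y → edge H x y w ≡ true
      join (here refl)         (here refl)         x≢y = contradiction refl x≢y
      join (here refl)         (there (here refl)) _   = e
      join (there (here refl)) (here refl)         _   = edge-swap₁₂ e
      join (there (here refl)) (there (here refl)) x≢y = contradiction refl x≢y

    -- The only new triples are those of d, w and an old vertex. The old part `a ∷ S` is nonempty,
    -- so some edge contains both d and w, whence w ≠ d.
    extends-∷ : ∀ {a S d w} → cliqueᵇ (d ∷ a ∷ S) ≡ true → extends (a ∷ S) w ≡ true →
      (∀ {x} → x ∈ a ∷ S → edge H x d w ≡ true) → extends (d ∷ a ∷ S) w ≡ true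
    extends-∷ {a} {S} {d} {w} clq ext e = ∧-true⁺
      (∉⇒not∈ᵇ {x = w} {d ∷ a ∷ S} λ { (here refl) → proj₁ (proj₂ (edge-distinct H _ _ _ (e (here refl)))) refl
                 ; (there w∈)  → w∉ w∈ })
      (isClique-complete _ (Clique-∷ (clique-sound {d ∷ a ∷ S} clq) join))
      where
      w∉ : w ∉ a ∷ S
      w∉ = proj₁ (extends-sound {a ∷ S} {w} ext)
      join : ∀ {x y} → x ∈ d ∷ a ∷ S → y ∈ d ∷ a ∷ S → x ≢ y → edge H x y w ≡ true
      join (here refl) (here refl) x≢y = contradiction refl x≢y
      join (here refl) (there y∈)  _   = edge-swap₁₂ (e y∈)
      join (there x∈)  (here refl) _   = e x∈
      join (there x∈)  (there y∈)  x≢y =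
        proj₂ (extends-sound {a ∷ S} {w} ext) (there x∈) (there y∈) (here refl) x≢y
          (λ { refl → w∉ y∈ }) (λ { refl → w∉ x∈ })

    isOrd5Clique≡cliqueᵇ : ∀ v₁ v₂ v₃ v₄ v₅ → isOrd5Cliqueᵇ H v₁ v₂ v₃ v₄ v₅ ≡ cliqueᵇ (v₁ ∷ v₂ ∷ v₃ ∷ v₄ ∷ v₅ ∷ [])
    isOrd5Clique≡cliqueᵇ v₁ v₂ v₃ v₄ v₅ = refl

    extends-↭ : ∀ {l m} → l ↭ m → ∀ u → extends l u ≡ extends m u
    extends-↭ l↭m u = cong₂ (λ b c → not b ∧ c) (∈ᵇ-↭ u l↭m) (isClique-↭ (prep u l↭m))

    Kcount≡count : ∀ S → Kcount H S ≡ count (extends S)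
    Kcount≡count S = refl

    clique-distinct : ∀ {l} → cliqueᵇ l ≡ true → distinctᵇ l ≡ true
    clique-distinct {l} h = proj₁ (∧-true⁻ {distinctᵇ l} h)

    clique-pair : ∀ {a b} → a ≢ b → cliqueᵇ (a ∷ b ∷ []) ≡ true
    clique-pair {a} {b} a≢b = ∧-true⁺
      (cong (λ c → not (c ∨ false) ∧ true) (==-no a≢b)) (isClique-complete _ (Clique-pair a b))

  κ : List (Fin n) → ℕ
  κ S = count (extends S)

  κ-↭ : ∀ {l m} → l ↭ m → κ l ≡ κ m
  κ-↭ l↭m = count-cong (extends-↭ l↭m)

-- The codegree condition

-- The first condition is strict although the cut only gives q ≤ 1/6: N - 6X is the lower bound for
-- the number of extensions of a 4-clique, which must be positive to be inverted.
Admissible : ℚ → ℚ → Set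
Admissible N X = 0ℚ <ℚ N - (X + X + X + X + X + X) × 0ℚ ≤ℚ cubic N X

admissible? : ∀ N X → Dec (Admissible N X)
admissible? N X = (0ℚ ℚ.<? _) ×-dec (0ℚ ℚ.≤? _)

admissible-0 : ∀ {N} → 0ℚ <ℚ N → Admissible N 0ℚ
admissible-0 {N} 0<N = subst (0ℚ <ℚ_) (linear N) 0<N ,
  subst (0ℚ ≤ℚ_) (cube N) (0≤* (0≤* 0≤N 0≤N) 0≤N)
  where
  0≤N = ℚ.<⇒≤ 0<N
  linear : ∀ N → N ≡ N - (0ℚ + 0ℚ + 0ℚ + 0ℚ + 0ℚ + 0ℚ)
  linear = solve-∀ ℚ-ring
  cube : ∀ N → N * N * N ≡ ((N - 0ℚ) * (N - (0ℚ + 0ℚ)) - 0ℚ * N) * (N - (0ℚ + 0ℚ) - (0ℚ + 0ℚ)) - (0ℚ + 0ℚ) * N * (N - (0ℚ + 0ℚ))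
  cube = solve-∀ ℚ-ring

-- N q will be a deficit and so is nonnegative: the case q ≤ 0 of the cut leaves only deficit 0. In
-- the other case `cubic N (N * q)` is -N³ p(q).
admissible-≤x* : ∀ {N q} → 0ℚ <ℚ N → 0ℚ ≤ℚ N * q → q ≤x* → Admissible N (N * q)
admissible-≤x* {N} {q} 0<N 0≤Nq (inj₁ q≤0) = subst (Admissible N) (sym Nq≡0) (admissible-0 0<N)
  where
  Nq≡0 : N * q ≡ 0ℚ
  Nq≡0 = ℚ.≤-antisym (subst (N * q ≤ℚ_) (ℚ.*-zeroʳ N) (*-monoˡ-0≤ (ℚ.<⇒≤ 0<N) q≤0)) 0≤Nq
admissible-≤x* {N} {q} 0<N 0≤Nq (inj₂ (q≤1/6 , pq≤0)) = 0<N-6X , 0≤cubic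
  where
  X = N * q
  0≤N = ℚ.<⇒≤ 0<N
  0≤cubic : 0ℚ ≤ℚ cubic N X
  0≤cubic = subst (0ℚ ≤ℚ_) (identity N q)
    (0≤* (0≤* (0≤* 0≤N 0≤N) 0≤N) (≤⇒0≤- pq≤0))
    where
    identity : ∀ N q → N * N * N * (0ℚ - (ℚ[ 8 ] * (q * q * q) - ℚ[ 22 ] * (q * q) + ℚ[ 10 ] * q - 1ℚ))
      ≡ ((N - N * q) * (N - (N * q + N * q)) - N * q * N) * (N - (N * q + N * q) - (N * q + N * q)) - (N * q + N * q) * N * (N - (N * q + N * q))
    identity = solve-∀ ℚ-ring
  0≤N-6X : 0ℚ ≤ℚ N - (X + X + X + X + X + X)
  0≤N-6X = subst (0ℚ ≤ℚ_) (identity N q) (0≤* (0≤* 0≤ℚ[ 6 ] 0≤N) (≤⇒0≤- q≤1/6))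
    where
    identity : ∀ N q → ℚ[ 6 ] * N * (ℤ.+ 1 / 6 - q) ≡ N - (N * q + N * q + N * q + N * q + N * q + N * q)
    identity = solve-∀ ℚ-ring
  -- The cubic is negative at X = N/6.
  0<N-6X : 0ℚ <ℚ N - (X + X + X + X + X + X)
  0<N-6X = ℚ.≰⇒> λ le → ℚ.<-irrefl refl
    (ℚ.<-≤-trans (0<20X³ (ℚ.≤-antisym le 0≤N-6X)) (vanishes (ℚ.≤-antisym le 0≤N-6X)))
    where
    N≡6X : N - (X + X + X + X + X + X) ≡ 0ℚ → N ≡ ℚ[ 6 ] * X
    N≡6X eq = trans (identity N X) (trans (cong (_+ ℚ[ 6 ] * X) eq) (ℚ.+-identityˡ (ℚ[ 6 ] * X)))
      where
      identity : ∀ N X → N ≡ N - (X + X + X + X + X + X) + ℚ[ 6 ] * X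
      identity = solve-∀ ℚ-ring
    0<X : N - (X + X + X + X + X + X) ≡ 0ℚ → 0ℚ <ℚ X
    0<X eq = ℚ.≰⇒> λ X≤0 → ℚ.<-irrefl refl (ℚ.<-≤-trans 0<N
      (subst (_≤ℚ 0ℚ) (sym (N≡6X eq)) (*-monoˡ-0≤ {X} {0ℚ} 0≤ℚ[ 6 ] X≤0)))
    0<* : ∀ {x y} → 0ℚ <ℚ x → 0ℚ <ℚ y → 0ℚ <ℚ x * y
    0<* {x} {y} 0<x 0<y = ℚ.positive⁻¹ (x * y) {{ℚ.pos*pos⇒pos x {{positive 0<x}} y {{positive 0<y}}}}
    0<20X³ : N - (X + X + X + X + X + X) ≡ 0ℚ → 0ℚ <ℚ ℚ[ 20 ] * (X * X * X)
    0<20X³ eq = 0<* (0<ℚ[_] {20} (s≤s z≤n)) (0<* (0<* (0<X eq) (0<X eq)) (0<X eq))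
    vanishes : N - (X + X + X + X + X + X) ≡ 0ℚ → ℚ[ 20 ] * (X * X * X) ≤ℚ 0ℚ
    vanishes eq = 0≤-⇒≤ (subst (0ℚ ≤ℚ_) (trans (cong (λ M → cubic M X) (N≡6X eq)) (identity X)) 0≤cubic)
      where
      identity : ∀ X → ((ℚ[ 6 ] * X - X) * (ℚ[ 6 ] * X - (X + X)) - X * (ℚ[ 6 ] * X)) * (ℚ[ 6 ] * X - (X + X) - (X + X)) - (X + X) * (ℚ[ 6 ] * X) * (ℚ[ 6 ] * X - (X + X))
        ≡ 0ℚ - ℚ[ 20 ] * (X * X * X)
      identity = solve-∀ ℚ-ring

largest : ∀ {P : ℕ → Set} → (∀ m → Dec (P m)) → P 0 → ∀ k →
  ∃ λ M → P M × (∀ j → j ℕ.≤ k → P j → j ℕ.≤ M)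
largest P? P0 zero = 0 , P0 , λ j j≤0 _ → j≤0
largest {P} P? P0 (suc k) with P? (suc k)
... | yes Pk = suc k , Pk , λ j j≤ _ → j≤
... | no ¬Pk with largest P? P0 k
...   | M , PM , max = M , PM , bound
  where
  bound : ∀ j → j ℕ.≤ suc k → P j → j ℕ.≤ M
  bound j j≤ Pj with ℕ.m≤n⇒m<n∨m≡n j≤
  ... | inj₁ (s≤s j≤k) = max j j≤k Pj
  ... | inj₂ refl      = contradiction Pj ¬Pk

ℚ-∸ : ∀ {d n} → d ℕ.≤ n → ℚ[ n ] ≡ ℚ[ n ℕ.∸ d ] + ℚ[ d ]
ℚ-∸ {d} {n} d≤n = trans (cong ℚ[_] {n} {n ℕ.∸ d ℕ.+ d} (sym (ℕ.m∸n+n≡m d≤n))) (ℚ-+ (n ℕ.∸ d) d)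

complement : ∀ {N f c d} → N * f ≡ d → N ≡ c + d → N * (1ℚ - f) ≡ c
complement {N} {f} {c} {d} Nf≡d N≡c+d = trans (expand N f) (trans (cong₂ _-_ N≡c+d Nf≡d) (cancel c d))
  where
  expand : ∀ N f → N * (1ℚ - f) ≡ N - N * f
  expand = solve-∀ ℚ-ring
  cancel : ∀ x y → x + y - y ≡ x
  cancel = solve-∀ ℚ-ring

deficit-admissible : ∀ {n} (H : Hypergraph3 n) → 0 ℕ.< n → MinEssCodegreeCond H →
  ∀ a b → InShadow H a b → Admissible ℚ[ n ] ℚ[ n ℕ.∸ deg H a b ]
deficit-admissible {n} H 0<n cond a b sh =
  subst (Admissible ℚ[ n ]) Nq≡ (admissible-≤x* (0<ℚ[_] {n} 0<n)
    (subst (0ℚ ≤ℚ_) (sym Nq≡) 0≤ℚ[ n ℕ.∸ deg H a b ]) (cond a b sh))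
  where
  Nq≡ : ℚ[ n ] * (1ℚ - frac (deg H a b) n) ≡ ℚ[ n ℕ.∸ deg H a b ]
  Nq≡ = complement {ℚ[ n ]} {frac (deg H a b) n} (ℚ*frac (deg H a b) 0<n) (ℚ-∸ (count-≤ (edge H a b)))

module Codegree {n : ℕ} (H : Hypergraph3 n) (0<n : 0 ℕ.< n) (cond : MinEssCodegreeCond H) where
  open Cliques H

  N X : ℚ
  N = ℚ[ n ]

  -- The hypothesis treats each pair separately, through its own rational deficit. The largest
  -- admissible integer up to n bounds all these deficits and itself satisfies the cubic inequality;
  -- it exists because admissibility is decidable and 0 is admissible.
  deficit = largest {λ m → Admissible N ℚ[ m ]} (λ m → admissible? N ℚ[ m ]) (admissible-0 (0<ℚ[_] {n} 0<n)) n

  X = ℚ[ proj₁ deficit ]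

  0<N-6X : 0ℚ <ℚ N - (X + X + X + X + X + X)
  0<N-6X = proj₁ (proj₁ (proj₂ deficit))

  0≤X : 0ℚ ≤ℚ X
  0≤X = 0≤ℚ[ proj₁ deficit ]

  N-X≤deg : ∀ {a b} → InShadow H a b → N - X ≤ℚ ℚ[ deg H a b ]
  N-X≤deg {a} {b} sh = 0≤-⇒≤ (subst (0ℚ ≤ℚ_) eq (≤⇒0≤- (ℚ-mono {n ℕ.∸ d} {proj₁ deficit} (proj₂ (proj₂ deficit) (n ℕ.∸ d) (ℕ.m∸n≤m n d)
      (deficit-admissible H 0<n cond a b sh)))))
    where
    d = deg H a b
    eq : X - ℚ[ n ℕ.∸ d ] ≡ ℚ[ d ] - (N - X)
    eq = trans (regroup X ℚ[ n ℕ.∸ d ] ℚ[ d ]) (cong (λ M → ℚ[ d ] - (M - X)) (sym (ℚ-∸ (count-≤ (edge H a b)))))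
      where
      regroup : ∀ X c d → X - c ≡ d - (c + d - X)
      regroup = solve-∀ ℚ-ring

  K : List (Fin n) → ℚ
  K S = ℚ[ κ S ]

  edge⇒shadow : ∀ {a b c} → edge H a b c ≡ true → InShadow H a b
  edge⇒shadow {a} {b} {c} e = proj₁ (edge-distinct H a b c e) ,
    ℚ-cancel-< {0} {deg H a b} (count-witness (edge H a b) c e)

  K≤N : ∀ S → K S ≤ℚ N
  K≤N S = ℚ-mono {κ S} {n} (count-≤ (extends S))

  extends⇒edge : ∀ {a b w} → a ≢ b → extends (a ∷ b ∷ []) w ≡ true → edge H a b w ≡ true
  extends⇒edge {a} {b} {w} a≢b h with extends-sound {a ∷ b ∷ []} h
  ... | w∉ , clq = clq (there (here refl)) (there (there (here refl))) (here refl) a≢b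
    (λ { refl → w∉ (there (here refl)) }) (λ { refl → w∉ (here refl) })

  K-pair : ∀ {a b} → a ≢ b → K (a ∷ b ∷ []) ≡ ℚ[ deg H a b ]
  K-pair {a} {b} a≢b = cong ℚ[_] {κ (a ∷ b ∷ [])} {deg H a b} (count-cong λ w → bool-ext (extends⇒edge a≢b) (edge⇒extends a b w))

  K-pair-≥ : ∀ {a b} → InShadow H a b → N - X ≤ℚ K (a ∷ b ∷ [])
  K-pair-≥ sh = subst (N - X ≤ℚ_) (sym (K-pair (proj₁ sh))) (N-X≤deg sh)

  clique-edge : ∀ {x y z l} → cliqueᵇ (x ∷ y ∷ z ∷ l) ≡ true → edge H x y z ≡ true
  clique-edge {x} {y} {z} {l} h = clique-sound h (here refl) (there (here refl)) (there (there (here refl)))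
    (λ { refl → x∉ (here refl) }) (λ { refl → y∉ (here refl) }) (λ { refl → x∉ (there (here refl)) })
    where
    d = clique-distinct h
    x∉ = not∈ᵇ⇒∉ {l = y ∷ z ∷ l} (proj₁ (∧-true⁻ {not (x ∈ᵇ (y ∷ z ∷ l))} d))
    y∉ = not∈ᵇ⇒∉ {l = z ∷ l} (proj₁ (∧-true⁻ {not (y ∈ᵇ (z ∷ l))} (proj₂ (∧-true⁻ {not (x ∈ᵇ (y ∷ z ∷ l))} d))))

  -- A vertex extends c, a, b if it extends a, b and forms edges with the pairs ac and bc. Only
  -- these two deficits are estimated by X; the count for ab stays exact, because the loss depends
  -- on it.
  K-triple-≥ : ∀ {a b c} → cliqueᵇ (c ∷ a ∷ b ∷ []) ≡ true → K (a ∷ b ∷ []) - (X + X) ≤ℚ K (c ∷ a ∷ b ∷ [])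
  K-triple-≥ {a} {b} {c} clq = ℚ.≤-trans (0≤-⇒≤ (subst (0ℚ ≤ℚ_)
      (identity N X (K (a ∷ b ∷ [])) ℚ[ deg H a c ] ℚ[ deg H b c ] ℚ[ count ac∧bc ])
      (0≤+ (≤⇒0≤- (count-∧ (edge H a c) (edge H b c)))
           (0≤+ (≤⇒0≤- (N-X≤deg (edge⇒shadow (edge-swap₁₂ cab))))
                (≤⇒0≤- (N-X≤deg (edge⇒shadow (edge-swap₁₂ (edge-swap₂₃ cab)))))))))
    (ℚ.≤-trans (count-∧ (extends (a ∷ b ∷ [])) ac∧bc) (count-mono imp))
    where
    cab : edge H c a b ≡ true
    cab = clique-edge clq
    ac∧bc : Fin n → Bool
    ac∧bc w = edge H a c w ∧ edge H b c w
    identity : ∀ N X k d e m → (m - (d + e - N)) + ((d - (N - X)) + (e - (N - X))) ≡ (k + m - N) - (k - (X + X))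
    identity = solve-∀ ℚ-ring
    imp : ∀ w → extends (a ∷ b ∷ []) w ∧ ac∧bc w ≡ true → extends (c ∷ a ∷ b ∷ []) w ≡ true
    imp w h with ∧-true⁻ {extends (a ∷ b ∷ []) w} h
    ... | ext , es with ∧-true⁻ {edge H a c w} es
    ...   | ea , eb = extends-∷ clq ext λ { (here refl) → ea ; (there (here refl)) → eb }

  -- Adding d to the clique a, b, c asks for edges with the pairs ad, bd and cd. The deficits of ad
  -- and bd are estimated by X, while that of cd stays exact: with c = u and d = v it is the deficit
  -- that causes the loss A₁₄₅ - A₃₄₅.
  K-quad-≥ : ∀ {a b c d} → cliqueᵇ (d ∷ a ∷ b ∷ c ∷ []) ≡ true →
    K (a ∷ b ∷ c ∷ []) + K (c ∷ d ∷ []) - (X + X) - N ≤ℚ K (d ∷ a ∷ b ∷ c ∷ [])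
  K-quad-≥ {a} {b} {c} {d} clq = ℚ.≤-trans (0≤-⇒≤ (subst (0ℚ ≤ℚ_)
      (trans (identity N X (K (a ∷ b ∷ c ∷ [])) ℚ[ deg H a d ] ℚ[ deg H b d ] ℚ[ deg H c d ] ℚ[ count bd∧cd ] ℚ[ count ad∧bd∧cd ])
        (cong (λ z → (K (a ∷ b ∷ c ∷ []) + ℚ[ count ad∧bd∧cd ] - N) - (K (a ∷ b ∷ c ∷ []) + z - (X + X) - N))
          (sym (K-pair (proj₁ (edge⇒shadow cda))))))
      (0≤+ (0≤+ (≤⇒0≤- (count-∧ (edge H a d) bd∧cd)) (≤⇒0≤- (count-∧ (edge H b d) (edge H c d))))
           (0≤+ (≤⇒0≤- (N-X≤deg (edge⇒shadow (edge-swap₁₂ dab))))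
                (≤⇒0≤- (N-X≤deg (edge⇒shadow (edge-swap₁₂ (edge-swap₂₃ dab)))))))))
    (ℚ.≤-trans (count-∧ (extends (a ∷ b ∷ c ∷ [])) ad∧bd∧cd) (count-mono imp))
    where
    dab : edge H d a b ≡ true
    dab = clique-edge clq
    cda : edge H c d a ≡ true
    cda = edge-swap₁₂ (edge-swap₂₃ (clique-edge (trans (clique-↭ (prep d (prep a (swap c b ↭-refl)))) clq)))
    bd∧cd ad∧bd∧cd : Fin n → Bool
    bd∧cd w = edge H b d w ∧ edge H c d w
    ad∧bd∧cd w = edge H a d w ∧ bd∧cd w
    identity : ∀ N X k x y z s t →
      ((t - (x + s - N)) + (s - (y + z - N))) + ((x - (N - X)) + (y - (N - X))) ≡ (k + t - N) - (k + z - (X + X) - N)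
    identity = solve-∀ ℚ-ring
    imp : ∀ w → extends (a ∷ b ∷ c ∷ []) w ∧ ad∧bd∧cd w ≡ true → extends (d ∷ a ∷ b ∷ c ∷ []) w ≡ true
    imp w h with ∧-true⁻ {extends (a ∷ b ∷ c ∷ []) w} h
    ... | ext , es with ∧-true⁻ {edge H a d w} es
    ...   | ea , es′ with ∧-true⁻ {edge H b d w} es′
    ...     | eb , ec = extends-∷ clq ext λ { (here refl) → ea ; (there (here refl)) → eb ; (there (there (here refl))) → ec }

-- Positions in an ordered 5-clique

-- A vertex x is recorded relative to (v₁, …, v₅) by the row of booleans x == vᵢ.  For distinct
-- vᵢ this row is code zero (x is absent) or code (suc i) (x is vᵢ), which reduces identities
-- about ψ_K to finitely many cases.

Row : ℕ → Set
Row = Vec Bool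

code : ∀ {m} → Fin (suc m) → Row m
code {zero}  zero          = []
code {suc m} zero          = false ∷ code zero
code {suc m} (suc zero)    = true ∷ code zero
code {suc m} (suc (suc i)) = false ∷ code (suc i)

-- The final `false`, like the final `true` in `ψᵣ`, copies the unfolding of `any` and `all`, so
-- that `ψK≡ψᵣ` becomes definitional once the tests of v₁ and v₂ against the edge are turned around.
occurs : Row 5 → Bool
occurs r = lookup r (# 0) ∨ (lookup r (# 1) ∨ (lookup r (# 2) ∨ (lookup r (# 3) ∨ (lookup r (# 4) ∨ false))))

ψᵣ : Row 5 → Row 5 → Row 5 → ℚ
ψᵣ r s t =
  if occurs r ∧ (occurs s ∧ (occurs t ∧ true))
  then (if (m₁ ∧ not m₂ ∨ not m₁ ∧ m₂) then ℤ.-[1+ 0 ] / 6 else ℤ.+ 1 / 3)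
  else 0ℚ
  where
  m₁ = lookup r (# 0) ∨ (lookup s (# 0) ∨ (lookup t (# 0) ∨ false))
  m₂ = lookup r (# 1) ∨ (lookup s (# 1) ∨ (lookup t (# 1) ∨ false))

-- Runs in step with `subseqᵇ`: the heads of the rows are the tests against the current vertex, and
-- passing to the next vertex takes tails.
subseqᵣ : ∀ {m} → List (Row m) → Bool
subseqᵣ         []       = true
subseqᵣ {zero}  (r ∷ rs) = false
subseqᵣ {suc m} (r ∷ rs) = if Vec.head r then subseqᵣ (map Vec.tail rs) else subseqᵣ (map Vec.tail (r ∷ rs))

ψ-inOrder : Row 5 → Row 5 → Row 5 → ℚ
ψ-inOrder r s t = if subseqᵣ (r ∷ s ∷ t ∷ []) then ψᵣ r s t else 0ℚ

Pattern : Set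
Pattern = Vec (Maybe (Fin 3)) 5

-- The ways for (x₁, x₂, x₃) to occur in order in (v₁, …, v₅), with the value of ψ_K on {x₁, x₂, x₃}.
patterns : List (Pattern × ℚ)
patterns =
    ((x₁ ∷ x₂ ∷ x₃ ∷ ∗  ∷ ∗  ∷ []) , 1/3)
  ∷ ((x₁ ∷ x₂ ∷ ∗  ∷ x₃ ∷ ∗  ∷ []) , 1/3)
  ∷ ((x₁ ∷ x₂ ∷ ∗  ∷ ∗  ∷ x₃ ∷ []) , 1/3)
  ∷ ((x₁ ∷ ∗  ∷ x₂ ∷ x₃ ∷ ∗  ∷ []) , -1/6)
  ∷ ((x₁ ∷ ∗  ∷ x₂ ∷ ∗  ∷ x₃ ∷ []) , -1/6)
  ∷ ((x₁ ∷ ∗  ∷ ∗  ∷ x₂ ∷ x₃ ∷ []) , -1/6)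
  ∷ ((∗  ∷ x₁ ∷ x₂ ∷ x₃ ∷ ∗  ∷ []) , -1/6)
  ∷ ((∗  ∷ x₁ ∷ x₂ ∷ ∗  ∷ x₃ ∷ []) , -1/6)
  ∷ ((∗  ∷ x₁ ∷ ∗  ∷ x₂ ∷ x₃ ∷ []) , -1/6)
  ∷ ((∗  ∷ ∗  ∷ x₁ ∷ x₂ ∷ x₃ ∷ []) , 1/3)
  ∷ []
  where
  ∗ x₁ x₂ x₃ : Maybe (Fin 3)
  ∗  = nothing
  x₁ = just (# 0)
  x₂ = just (# 1)
  x₃ = just (# 2)
  1/3 -1/6 : ℚ
  1/3  = ℤ.+ 1 / 3
  -1/6 = ℤ.-[1+ 0 ] / 6

matches : (Fin 3 → Fin 5 → Bool) → Pattern → ℚ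
matches b π = at (# 0) * (at (# 1) * (at (# 2) * (at (# 3) * at (# 4))))
  where
  at : Fin 5 → ℚ
  at i = maybe (λ j → 𝟙 (b j i)) 1ℚ (lookup π i)

rows : Row 5 → Row 5 → Row 5 → Fin 3 → Fin 5 → Bool
rows r s t j i = lookup (lookup (r ∷ s ∷ t ∷ []) j) i

-- Distinct vertices may both be absent, but cannot share a position.
compatible : Fin 6 → Fin 6 → Bool
compatible zero    d = true
compatible (suc c) d = not (suc c == d)

Compatible₃ : Fin 6 → Fin 6 → Fin 6 → Set
Compatible₃ c d e = compatible c d ∧ (compatible d e ∧ compatible c e) ≡ true

-- There are 216 triples of codes. Both sides are evaluated as rationals on the compatible ones, and
-- this evaluation discharges the implicit argument of `by-cases`.
check₃ : (f g : Fin 6 → Fin 6 → Fin 6 → ℚ) → Dec (∀ c d e → Compatible₃ c d e → f c d e ≡ g c d e)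
check₃ f g = Fin.all? λ c → Fin.all? λ d → Fin.all? λ e → (_ Bool.≟ true) →-dec (f c d e ℚ.≟ g c d e)

by-cases : ∀ {f g} → {True (check₃ f g)} → ∀ c d e → Compatible₃ c d e → f c d e ≡ g c d e
by-cases {f} {g} {ok} = toWitness ok

patterns-correct : ∀ c d e → Compatible₃ c d e →
  ψ-inOrder (code c) (code d) (code e)
    ≡ sumList (λ (π , q) → q * matches (rows (code c) (code d) (code e)) π) patterns
patterns-correct = by-cases

ψ-orderings : ∀ c d e → Compatible₃ c d e →
  ψᵣ (code c) (code d) (code e)
    ≡ ψ-inOrder (code c) (code d) (code e) + (ψ-inOrder (code c) (code e) (code d)
      + (ψ-inOrder (code d) (code c) (code e) + (ψ-inOrder (code d) (code e) (code c)
      + (ψ-inOrder (code e) (code c) (code d) + ψ-inOrder (code e) (code d) (code c)))))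
ψ-orderings = by-cases

-- Turns a sum over all third vertices into one over the five positions. If the third vertex is
-- absent, both sides are 0.
ψ-third : ∀ c d e →
  ψᵣ (code c) (code d) (code e) ≡ Σᵥ (λ i → 𝟙 (lookup (code e) i) * ψᵣ (code c) (code d) (code (suc i)))
ψ-third = toWitness {a? = Fin.all? λ c → Fin.all? λ d → Fin.all? λ e →
  ψᵣ (code c) (code d) (code e) ℚ.≟ Σᵥ (λ i → 𝟙 (lookup (code e) i) * ψᵣ (code c) (code d) (code (suc i)))} _

-- ψ_K sums to 1 over the edges through the pair {v₁, v₂} and to 0 over those through any other pair.
ψ-pair-sum : ∀ c d → compatible c d ≡ true →
  Σᵥ (λ i → 𝟙 (not (c == suc i) ∧ not (d == suc i)) * ψᵣ (code c) (code d) (code (suc i)))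
    ≡ 𝟙 (lookup (code c) (# 0)) * 𝟙 (lookup (code d) (# 1)) + 𝟙 (lookup (code d) (# 0)) * 𝟙 (lookup (code c) (# 1))
ψ-pair-sum = toWitness {a? = Fin.all? λ c → Fin.all? λ d → (compatible c d Bool.≟ true) →-dec (_ ℚ.≟ _)} _

ψ-absent : ∀ c i → ψᵣ (code c) (code zero) (code (suc i)) ≡ 0ℚ
ψ-absent = toWitness {a? = Fin.all? λ c → Fin.all? λ i → ψᵣ (code c) (code zero) (code (suc i)) ℚ.≟ 0ℚ} _

module _ {n : ℕ} where

  row : ∀ {m} → Vec (Fin n) m → Fin n → Row m
  row vs x = Vec.map (x ==_) vs

  Distinct : ∀ {m} → Vec (Fin n) m → Set
  Distinct vs = distinctᵇ (Vec.toList vs) ≡ true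

  lookup-row : ∀ {m} (vs : Vec (Fin n) m) x i → lookup (row vs x) i ≡ (x == lookup vs i)
  lookup-row (v ∷ vs) x zero    = refl
  lookup-row (v ∷ vs) x (suc i) = lookup-row vs x i

  lookup-∈ : ∀ {m} (vs : Vec (Fin n) m) i → lookup vs i ∈ Vec.toList vs
  lookup-∈ (v ∷ vs) zero    = here refl
  lookup-∈ (v ∷ vs) (suc i) = there (lookup-∈ vs i)

  lookup-injective : ∀ {m} (vs : Vec (Fin n) m) → Distinct vs → ∀ i j → lookup vs i ≡ lookup vs j → i ≡ j
  lookup-injective (v ∷ vs) d zero    zero    eq = refl
  lookup-injective (v ∷ vs) d zero    (suc j) eq = contradiction
    (subst (_∈ Vec.toList vs) (sym eq) (lookup-∈ vs j)) (not∈ᵇ⇒∉ (proj₁ (∧-true⁻ {not (v ∈ᵇ Vec.toList vs)} d)))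
  lookup-injective (v ∷ vs) d (suc i) zero    eq = contradiction
    (subst (_∈ Vec.toList vs) eq (lookup-∈ vs i)) (not∈ᵇ⇒∉ (proj₁ (∧-true⁻ {not (v ∈ᵇ Vec.toList vs)} d)))
  lookup-injective (v ∷ vs) d (suc i) (suc j) eq =
    cong suc (lookup-injective vs (proj₂ (∧-true⁻ {not (v ∈ᵇ Vec.toList vs)} d)) i j eq)

  row-absent : ∀ {m} x (vs : Vec (Fin n) m) → not (x ∈ᵇ Vec.toList vs) ≡ true → row vs x ≡ code zero
  row-absent x []       h = refl
  row-absent x (v ∷ vs) h with x == v
  ... | false = cong (false ∷_) (row-absent x vs h)

  record Located {m} (vs : Vec (Fin n) m) (x : Fin n) : Set where
    constructor located
    field
      position  : Fin (suc m)
      row≡code  : row vs x ≡ code position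
      found     : ∀ i → position ≡ suc i → x ≡ lookup vs i
  open Located public

  locate : ∀ {m} (vs : Vec (Fin n) m) → Distinct vs → ∀ x → Located vs x
  locate []       d x = located zero refl λ ()
  locate (v ∷ vs) d x with x Fin.≟ v
  ... | yes x≡v = located (suc zero)
    (cong₂ _∷_ (==-yes x≡v) (row-absent x vs (proj₁ (∧-true⁻ {not (x ∈ᵇ Vec.toList vs)}
      (subst (λ u → Distinct (u ∷ vs)) (sym x≡v) d))))) λ { zero _ → x≡v }
  ... | no  x≢v with locate vs (proj₂ (∧-true⁻ {not (v ∈ᵇ Vec.toList vs)} d)) x
  ...   | located zero    eq at = located zero (cong₂ _∷_ (==-no x≢v) eq) λ _ ()
  ...   | located (suc c) eq at = located (suc (suc c)) (cong₂ _∷_ (==-no x≢v) eq) λ { (suc i) refl → at i refl }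

  compatible-≢ : ∀ {vs : Vec (Fin n) 5} {x y} → x ≢ y → (p : Located vs x) (q : Located vs y) →
    compatible (position p) (position q) ≡ true
  compatible-≢ x≢y (located zero    _ _) q = refl
  compatible-≢ x≢y (located (suc c) _ at) (located d _ at′) with suc c Fin.≟ d
  ... | yes refl = contradiction (trans (at c refl) (sym (at′ c refl))) x≢y
  ... | no _     = refl

  -- The rows of distinct vertices are pairwise compatible codes, so a finite check on codes carries
  -- over to all vertices.
  on-codes : ∀ {vs : Vec (Fin n) 5} → Distinct vs → ∀ {x y z} → x ≢ y → y ≢ z → x ≢ z →
    (P : Row 5 → Row 5 → Row 5 → Set) → (∀ c d e → Compatible₃ c d e → P (code c) (code d) (code e)) →
    P (row vs x) (row vs y) (row vs z)
  on-codes {vs} dist {x} {y} {z} x≢y y≢z x≢z P h =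
    transport (row≡code (at x)) (row≡code (at y)) (row≡code (at z))
      (h (position (at x)) (position (at y)) (position (at z))
        (∧-true⁺ (compatible-≢ x≢y (at x) (at y))
          (∧-true⁺ (compatible-≢ y≢z (at y) (at z)) (compatible-≢ x≢z (at x) (at z)))))
    where
    at : ∀ u → Located vs u
    at = locate vs dist
    transport : ∀ {r s t r′ s′ t′} → r ≡ r′ → s ≡ s′ → t ≡ t′ → P r′ s′ t′ → P r s t
    transport refl refl refl p = p

  ψK≡ψᵣ : ∀ v₁ v₂ v₃ v₄ v₅ x y z → let vs = v₁ ∷ v₂ ∷ v₃ ∷ v₄ ∷ v₅ ∷ [] in
    ψK v₁ v₂ v₃ v₄ v₅ x y z ≡ ψᵣ (row vs x) (row vs y) (row vs z)
  ψK≡ψᵣ v₁ v₂ v₃ v₄ v₅ x y z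
    rewrite ==-sym v₁ x | ==-sym v₁ y | ==-sym v₁ z | ==-sym v₂ x | ==-sym v₂ y | ==-sym v₂ z = refl

-- Iterated sums, and sums with some coordinates pinned to given vertices

module _ {n : ℕ} where

  Σ₂-*ˡ : ∀ c (f : Fin n → Fin n → ℚ) →
    Σᵥ (λ v → Σᵥ λ w → c * f v w) ≡ c * Σᵥ (λ v → Σᵥ λ w → f v w)
  Σ₂-*ˡ c f = trans (Σ-cong λ v → Σ-*ˡ c (f v)) (Σ-*ˡ c λ v → Σᵥ (f v))

  Σ₃-*ˡ : ∀ c (f : Fin n → Fin n → Fin n → ℚ) →
    Σᵥ (λ u → Σᵥ λ v → Σᵥ λ w → c * f u v w) ≡ c * Σᵥ (λ u → Σᵥ λ v → Σᵥ λ w → f u v w)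
  Σ₃-*ˡ c f = trans (Σ-cong λ u → Σ₂-*ˡ c (f u)) (Σ-*ˡ c λ u → Σᵥ λ v → Σᵥ (f u v))

  Σ₄-*ˡ : ∀ c (f : Fin n → Fin n → Fin n → Fin n → ℚ) →
    Σᵥ (λ t → Σᵥ λ u → Σᵥ λ v → Σᵥ λ w → c * f t u v w) ≡ c * Σᵥ (λ t → Σᵥ λ u → Σᵥ λ v → Σᵥ λ w → f t u v w)
  Σ₄-*ˡ c f = trans (Σ-cong λ t → Σ₃-*ˡ c (f t)) (Σ-*ˡ c λ t → Σᵥ λ u → Σᵥ λ v → Σᵥ (f t u v))

  Σ₅-*ˡ : ∀ c (f : Fin n → Fin n → Fin n → Fin n → Fin n → ℚ) →
    Σ₅ (λ s t u v w → c * f s t u v w) ≡ c * Σ₅ f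
  Σ₅-*ˡ c f = trans (Σ-cong λ s → Σ₄-*ˡ c (f s)) (Σ-*ˡ c λ s → Σᵥ λ t → Σᵥ λ u → Σᵥ λ v → Σᵥ (f s t u v))

  Σ₅-cong : {f g : Fin n → Fin n → Fin n → Fin n → Fin n → ℚ} →
    (∀ s t u v w → f s t u v w ≡ g s t u v w) → Σ₅ f ≡ Σ₅ g
  Σ₅-cong eq = Σ-cong λ s → Σ-cong λ t → Σ-cong λ u → Σ-cong λ v → Σ-cong (eq s t u v)

  Σ₅-sumList : ∀ {A : Set} (f : A → Fin n → Fin n → Fin n → Fin n → Fin n → ℚ) (l : List A) →
    Σ₅ (λ s t u v w → sumList (λ p → f p s t u v w) l) ≡ sumList (λ p → Σ₅ (f p)) l
  Σ₅-sumList f l =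
    trans (Σ-cong λ s → trans (Σ-cong λ t → trans (Σ-cong λ u → trans (Σ-cong λ v →
      out (λ w p → f p s t u v w))
      (out λ v p → Σᵥ λ w → f p s t u v w))
      (out λ u p → Σᵥ λ v → Σᵥ λ w → f p s t u v w))
      (out λ t p → Σᵥ λ u → Σᵥ λ v → Σᵥ λ w → f p s t u v w))
      (out λ s p → Σᵥ λ t → Σᵥ λ u → Σᵥ λ v → Σᵥ λ w → f p s t u v w)
    where
    out : (h : Fin n → _ → ℚ) → Σᵥ (λ v → sumList (h v) l) ≡ sumList (λ p → Σᵥ λ v → h v p) l
    out h = sumList-swap h (allFin n) l

  Σ₅-+ : (f g : Fin n → Fin n → Fin n → Fin n → Fin n → ℚ) →
    Σ₅ (λ s t u v w → f s t u v w + g s t u v w) ≡ Σ₅ f + Σ₅ g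
  Σ₅-+ f g =
    trans (Σ-cong λ s → trans (Σ-cong λ t → trans (Σ-cong λ u → trans (Σ-cong λ v →
      Σ-+ (f s t u v) (g s t u v))
      (Σ-+ (λ v → Σᵥ (f s t u v)) (λ v → Σᵥ (g s t u v))))
      (Σ-+ (λ u → Σᵥ λ v → Σᵥ (f s t u v)) (λ u → Σᵥ λ v → Σᵥ (g s t u v))))
      (Σ-+ (λ t → Σᵥ λ u → Σᵥ λ v → Σᵥ (f s t u v)) (λ t → Σᵥ λ u → Σᵥ λ v → Σᵥ (g s t u v))))
      (Σ-+ (λ s → Σᵥ λ t → Σᵥ λ u → Σᵥ λ v → Σᵥ (f s t u v)) (λ s → Σᵥ λ t → Σᵥ λ u → Σᵥ λ v → Σᵥ (g s t u v)))

  module Pinned (x : Fin 3 → Fin n) where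

    pin : Maybe (Fin 3) → Fin n → ℚ
    pin m v = maybe (λ j → 𝟙 (x j == v)) 1ℚ m

    Σpin : Maybe (Fin 3) → (Fin n → ℚ) → ℚ
    Σpin nothing  f = Σᵥ f
    Σpin (just j) f = f (x j)

    Σpin-correct : ∀ m f → Σᵥ (λ v → pin m v * f v) ≡ Σpin m f
    Σpin-correct nothing  f = Σ-cong λ v → ℚ.*-identityˡ (f v)
    Σpin-correct (just j) f = Σ-select (x j) f

    Σpin-cong : ∀ m {f g} → (∀ v → f v ≡ g v) → Σpin m f ≡ Σpin m g
    Σpin-cong nothing  eq = Σ-cong eq
    Σpin-cong (just j) eq = eq (x j)

    Σ₅pin : Pattern → (Fin n → Fin n → Fin n → Fin n → Fin n → ℚ) → ℚ
    Σ₅pin (a ∷ b ∷ c ∷ d ∷ e ∷ []) f =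
      Σpin a λ v₁ → Σpin b λ v₂ → Σpin c λ v₃ → Σpin d λ v₄ → Σpin e λ v₅ → f v₁ v₂ v₃ v₄ v₅

    pins : Pattern → Fin n → Fin n → Fin n → Fin n → Fin n → ℚ
    pins (a ∷ b ∷ c ∷ d ∷ e ∷ []) v₁ v₂ v₃ v₄ v₅ = pin a v₁ * (pin b v₂ * (pin c v₃ * (pin d v₄ * pin e v₅)))

    -- Each factor is constant in the sums further inside, so it can be moved out to its own
    -- coordinate, where an indicator selects a single value.
    Σ₅pin-correct : ∀ π f → Σ₅ (λ v₁ v₂ v₃ v₄ v₅ → pins π v₁ v₂ v₃ v₄ v₅ * f v₁ v₂ v₃ v₄ v₅) ≡ Σ₅pin π f
    Σ₅pin-correct (a ∷ b ∷ c ∷ d ∷ e ∷ []) f = begin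
      Σ₅ (λ v₁ v₂ v₃ v₄ v₅ → pins (a ∷ b ∷ c ∷ d ∷ e ∷ []) v₁ v₂ v₃ v₄ v₅ * f v₁ v₂ v₃ v₄ v₅)
        ≡⟨ Σ₅-cong (λ v₁ v₂ v₃ v₄ v₅ → assoc (pin a v₁) (pin b v₂) (pin c v₃) (pin d v₄) (pin e v₅) (f v₁ v₂ v₃ v₄ v₅)) ⟩
      Σ₅ (λ v₁ v₂ v₃ v₄ v₅ → pin a v₁ * (pin b v₂ * (pin c v₃ * (pin d v₄ * (pin e v₅ * f v₁ v₂ v₃ v₄ v₅)))))
        ≡⟨ pull a (λ v₁ → Σ₄-*ˡ (pin a v₁) (λ v₂ v₃ v₄ v₅ → pin b v₂ * (pin c v₃ * (pin d v₄ * (pin e v₅ * f v₁ v₂ v₃ v₄ v₅)))))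
            (λ v₁ → pull b (λ v₂ → Σ₃-*ˡ (pin b v₂) (λ v₃ v₄ v₅ → pin c v₃ * (pin d v₄ * (pin e v₅ * f v₁ v₂ v₃ v₄ v₅))))
            (λ v₂ → pull c (λ v₃ → Σ₂-*ˡ (pin c v₃) (λ v₄ v₅ → pin d v₄ * (pin e v₅ * f v₁ v₂ v₃ v₄ v₅)))
            (λ v₃ → pull d (λ v₄ → Σ-*ˡ (pin d v₄) (λ v₅ → pin e v₅ * f v₁ v₂ v₃ v₄ v₅))
            (λ v₄ → Σpin-correct e (f v₁ v₂ v₃ v₄))))) ⟩
      Σ₅pin (a ∷ b ∷ c ∷ d ∷ e ∷ []) f ∎
      where
      open ≡-Reasoning
      assoc : ∀ a b c d e f → a * (b * (c * (d * e))) * f ≡ a * (b * (c * (d * (e * f))))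
      assoc = solve-∀ ℚ-ring
      pull : ∀ m {f g h : Fin n → ℚ} → (∀ v → f v ≡ pin m v * g v) → (∀ v → g v ≡ h v) → Σᵥ f ≡ Σpin m h
      pull m {f} {g} {h} fg gh = trans (Σ-cong fg) (trans (Σpin-correct m g) (Σpin-cong m gh))

-- Expansion of w_H(O) into the ten sums A_ijk

module Expansion {n : ℕ} (H : Hypergraph3 n) where
  open Cliques H

  weight : Fin n → Fin n → Fin n → Fin n → ℚ
  weight v₁ v₂ v₃ v₄ = inv (κ (v₁ ∷ v₂ ∷ [])) * inv (κ (v₁ ∷ v₂ ∷ v₃ ∷ [])) * inv (κ (v₁ ∷ v₂ ∷ v₃ ∷ v₄ ∷ []))

  W₄≡weight : ∀ v₁ v₂ v₃ v₄ → W₄ H v₁ v₂ v₃ v₄ ≡ weight v₁ v₂ v₃ v₄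
  W₄≡weight v₁ v₂ v₃ v₄ = cong₂ _*_ (cong₂ _*_ (cong inv (Kcount≡count (v₁ ∷ v₂ ∷ [])))
    (cong inv (Kcount≡count (v₁ ∷ v₂ ∷ v₃ ∷ [])))) (cong inv (Kcount≡count (v₁ ∷ v₂ ∷ v₃ ∷ v₄ ∷ [])))

  -- Starting from (v₁, v₂), choose each next vertex uniformly among those that extend the clique so
  -- far: this is the probability of drawing v₃, v₄, v₅ in turn. Hence the telescoping sums.
  mass : Fin n → Fin n → Fin n → Fin n → Fin n → ℚ
  mass v₁ v₂ v₃ v₄ v₅ = 𝟙 (cliqueᵇ (v₁ ∷ v₂ ∷ v₃ ∷ v₄ ∷ v₅ ∷ [])) * weight v₁ v₂ v₃ v₄

  -- `mass` vanishes off the ordered 5-cliques, so identities for ψ may assume five distinct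
  -- vertices forming a clique.
  mass-cong : ∀ v₁ v₂ v₃ v₄ v₅ {f g} →
    (cliqueᵇ (v₁ ∷ v₂ ∷ v₃ ∷ v₄ ∷ v₅ ∷ []) ≡ true → f ≡ g) → mass v₁ v₂ v₃ v₄ v₅ * f ≡ mass v₁ v₂ v₃ v₄ v₅ * g
  mass-cong v₁ v₂ v₃ v₄ v₅ {f} {g} eq = go (cliqueᵇ (v₁ ∷ v₂ ∷ v₃ ∷ v₄ ∷ v₅ ∷ [])) eq
    where
    vanish : ∀ w f → 0ℚ * w * f ≡ 0ℚ
    vanish = solve-∀ ℚ-ring
    go : ∀ b → (b ≡ true → f ≡ g) → 𝟙 b * weight v₁ v₂ v₃ v₄ * f ≡ 𝟙 b * weight v₁ v₂ v₃ v₄ * g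
    go true  eq = cong (1ℚ * weight v₁ v₂ v₃ v₄ *_) (eq refl)
    go false eq = trans (vanish (weight v₁ v₂ v₃ v₄) f) (sym (vanish (weight v₁ v₂ v₃ v₄) g))

  integrand : ∀ v₁ v₂ v₃ v₄ v₅ b y →
    (if isOrd5Cliqueᵇ H v₁ v₂ v₃ v₄ v₅ ∧ b then W₄ H v₁ v₂ v₃ v₄ * y else 0ℚ)
      ≡ mass v₁ v₂ v₃ v₄ v₅ * (if b then y else 0ℚ)
  integrand v₁ v₂ v₃ v₄ v₅ b y =
    trans (cong₂ (λ c w → if c ∧ b then w * y else 0ℚ) (isOrd5Clique≡cliqueᵇ v₁ v₂ v₃ v₄ v₅) (W₄≡weight v₁ v₂ v₃ v₄))
      (go (cliqueᵇ (v₁ ∷ v₂ ∷ v₃ ∷ v₄ ∷ v₅ ∷ [])) b (weight v₁ v₂ v₃ v₄))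
    where
    go : ∀ c b w → (if c ∧ b then w * y else 0ℚ) ≡ 𝟙 c * w * (if b then y else 0ℚ)
    go false b     w = sym (trans (cong (_* (if b then y else 0ℚ)) (ℚ.*-zeroˡ w)) (ℚ.*-zeroˡ (if b then y else 0ℚ)))
    go true  false w = sym (ℚ.*-zeroʳ (1ℚ * w))
    go true  true  w = cong (_* y) (sym (ℚ.*-identityˡ w))

  wO-integrand : ∀ v₁ v₂ v₃ v₄ v₅ x y z → let vs = v₁ ∷ v₂ ∷ v₃ ∷ v₄ ∷ v₅ ∷ [] in
    (if isOrd5Cliqueᵇ H v₁ v₂ v₃ v₄ v₅ ∧ subseqᵇ (x ∷ y ∷ z ∷ []) (v₁ ∷ v₂ ∷ v₃ ∷ v₄ ∷ v₅ ∷ [])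
     then W₄ H v₁ v₂ v₃ v₄ * ψK v₁ v₂ v₃ v₄ v₅ x y z else 0ℚ)
    ≡ mass v₁ v₂ v₃ v₄ v₅ * ψ-inOrder (row vs x) (row vs y) (row vs z)
  wO-integrand v₁ v₂ v₃ v₄ v₅ x y z =
    trans (integrand v₁ v₂ v₃ v₄ v₅ inOrder (ψK v₁ v₂ v₃ v₄ v₅ x y z))
      (cong (λ t → mass v₁ v₂ v₃ v₄ v₅ * (if inOrder then t else 0ℚ)) (ψK≡ψᵣ v₁ v₂ v₃ v₄ v₅ x y z))
    where
    inOrder : Bool
    inOrder = subseqᵇ (x ∷ y ∷ z ∷ []) (v₁ ∷ v₂ ∷ v₃ ∷ v₄ ∷ v₅ ∷ [])

  -- The containment test in `wE` occurs again inside `ψK`, so the nested tests collapse into one.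
  wE-integrand : ∀ v₁ v₂ v₃ v₄ v₅ x y z → let vs = v₁ ∷ v₂ ∷ v₃ ∷ v₄ ∷ v₅ ∷ [] in
    (if isOrd5Cliqueᵇ H v₁ v₂ v₃ v₄ v₅ ∧ all (λ t → t ∈ᵇ (v₁ ∷ v₂ ∷ v₃ ∷ v₄ ∷ v₅ ∷ [])) (x ∷ y ∷ z ∷ [])
     then W₄ H v₁ v₂ v₃ v₄ * ψK v₁ v₂ v₃ v₄ v₅ x y z else 0ℚ)
    ≡ mass v₁ v₂ v₃ v₄ v₅ * ψᵣ (row vs x) (row vs y) (row vs z)
  wE-integrand v₁ v₂ v₃ v₄ v₅ x y z =
    trans (integrand v₁ v₂ v₃ v₄ v₅ contained (ψK v₁ v₂ v₃ v₄ v₅ x y z))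
      (cong (mass v₁ v₂ v₃ v₄ v₅ *_) (trans (absorb contained) (ψK≡ψᵣ v₁ v₂ v₃ v₄ v₅ x y z)))
    where
    contained : Bool
    contained = all (λ t → t ∈ᵇ (v₁ ∷ v₂ ∷ v₃ ∷ v₄ ∷ v₅ ∷ [])) (x ∷ y ∷ z ∷ [])
    absorb : ∀ b {q} → (if b then (if b then q else 0ℚ) else 0ℚ) ≡ (if b then q else 0ℚ)
    absorb false = refl
    absorb true  = refl

  module _ {x y z : Fin n} (x≢y : x ≢ y) (y≢z : y ≢ z) (x≢z : x ≢ z) where
    open Pinned (lookup (x ∷ y ∷ z ∷ [])) 

    matches≡pins : ∀ v₁ v₂ v₃ v₄ v₅ π → let vs = v₁ ∷ v₂ ∷ v₃ ∷ v₄ ∷ v₅ ∷ [] in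
      matches (rows (row vs x) (row vs y) (row vs z)) π ≡ pins π v₁ v₂ v₃ v₄ v₅
    matches≡pins v₁ v₂ v₃ v₄ v₅ (a ∷ b ∷ c ∷ d ∷ e ∷ []) =
      cong₂ _*_ (entry (# 0) a) (cong₂ _*_ (entry (# 1) b) (cong₂ _*_ (entry (# 2) c) (cong₂ _*_ (entry (# 3) d) (entry (# 4) e))))
      where
      vs = v₁ ∷ v₂ ∷ v₃ ∷ v₄ ∷ v₅ ∷ []
      entry : ∀ i m → maybe (λ j → 𝟙 (rows (row vs x) (row vs y) (row vs z) j i)) 1ℚ m ≡ pin m (lookup vs i)
      entry i nothing                 = refl
      entry i (just zero)             = cong 𝟙 (lookup-row vs x i)
      entry i (just (suc zero))       = cong 𝟙 (lookup-row vs y i)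
      entry i (just (suc (suc zero))) = cong 𝟙 (lookup-row vs z i)

    ψ-inOrder≡patterns : ∀ v₁ v₂ v₃ v₄ v₅ → let vs = v₁ ∷ v₂ ∷ v₃ ∷ v₄ ∷ v₅ ∷ [] in Distinct vs →
      ψ-inOrder (row vs x) (row vs y) (row vs z)
        ≡ sumList (λ (π , q) → q * matches (rows (row vs x) (row vs y) (row vs z)) π) patterns
    ψ-inOrder≡patterns v₁ v₂ v₃ v₄ v₅ d = on-codes {vs = v₁ ∷ v₂ ∷ v₃ ∷ v₄ ∷ v₅ ∷ []} d x≢y y≢z x≢z
      (λ r s t → ψ-inOrder r s t ≡ sumList (λ (π , q) → q * matches (rows r s t) π) patterns) patterns-correct

    wO-expansion : wO H x y z ≡ ½ * sumList (λ (π , q) → q * Σ₅pin π mass) patterns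
    wO-expansion = cong (½ *_) (trans (Σ₅-cong pointwise)
      (trans (Σ₅-sumList (λ (π , q) v₁ v₂ v₃ v₄ v₅ → q * (pins π v₁ v₂ v₃ v₄ v₅ * mass v₁ v₂ v₃ v₄ v₅)) patterns)
        (sumList-cong patterns λ (π , q) →
          trans (Σ₅-*ˡ q (λ v₁ v₂ v₃ v₄ v₅ → pins π v₁ v₂ v₃ v₄ v₅ * mass v₁ v₂ v₃ v₄ v₅))
            (cong (q *_) (Σ₅pin-correct π mass)))))
      where
      regroup : ∀ m q p → m * (q * p) ≡ q * (p * m)
      regroup = solve-∀ ℚ-ring
      pointwise : ∀ v₁ v₂ v₃ v₄ v₅ →
        (if isOrd5Cliqueᵇ H v₁ v₂ v₃ v₄ v₅ ∧ subseqᵇ (x ∷ y ∷ z ∷ []) (v₁ ∷ v₂ ∷ v₃ ∷ v₄ ∷ v₅ ∷ [])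
         then W₄ H v₁ v₂ v₃ v₄ * ψK v₁ v₂ v₃ v₄ v₅ x y z else 0ℚ)
        ≡ sumList (λ (π , q) → q * (pins π v₁ v₂ v₃ v₄ v₅ * mass v₁ v₂ v₃ v₄ v₅)) patterns
      pointwise v₁ v₂ v₃ v₄ v₅ = begin
        _ ≡⟨ wO-integrand v₁ v₂ v₃ v₄ v₅ x y z ⟩
        μ * ψ-inOrder (row vs x) (row vs y) (row vs z)
          ≡⟨ mass-cong v₁ v₂ v₃ v₄ v₅ (λ clq → ψ-inOrder≡patterns v₁ v₂ v₃ v₄ v₅ (clique-distinct clq)) ⟩
        μ * sumList (λ (π , q) → q * matches (rows (row vs x) (row vs y) (row vs z)) π) patterns
          ≡⟨ sumList-*ˡ μ (λ (π , q) → q * matches (rows (row vs x) (row vs y) (row vs z)) π) patterns ⟨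
        sumList (λ (π , q) → μ * (q * matches (rows (row vs x) (row vs y) (row vs z)) π)) patterns
          ≡⟨ sumList-cong patterns (λ (π , q) → trans (regroup μ q (matches (rows (row vs x) (row vs y) (row vs z)) π))
               (cong (λ t → q * (t * μ)) (matches≡pins v₁ v₂ v₃ v₄ v₅ π))) ⟩
        sumList (λ (π , q) → q * (pins π v₁ v₂ v₃ v₄ v₅ * μ)) patterns ∎
        where
        open ≡-Reasoning
        vs = v₁ ∷ v₂ ∷ v₃ ∷ v₄ ∷ v₅ ∷ []
        μ = mass v₁ v₂ v₃ v₄ v₅

-- Positive extension counts and telescoping sums of the weight

module Weights {n : ℕ} (H : Hypergraph3 n) (0<n : 0 ℕ.< n) (cond : MinEssCodegreeCond H) where
  open Cliques H
  open Expansion H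
  open Codegree H 0<n cond

  clique-tail : ∀ {u S} → cliqueᵇ (u ∷ S) ≡ true → cliqueᵇ S ≡ true
  clique-tail {u} {S} h = proj₁ (∧-true⁻ {cliqueᵇ S} (trans (sym (clique-∷ u S)) h))

  clique-extends : ∀ {u S} → cliqueᵇ (u ∷ S) ≡ true → extends S u ≡ true
  clique-extends {u} {S} h = proj₂ (∧-true⁻ {cliqueᵇ S} (trans (sym (clique-∷ u S)) h))

  clique-perm : ∀ {l m} → l ↭ m → cliqueᵇ l ≡ true → cliqueᵇ m ≡ true
  clique-perm l↭m h = trans (sym (clique-↭ l↭m)) h

  K-↭ : ∀ {l m} → l ↭ m → K l ≡ K m
  K-↭ {l} {m} l↭m = cong ℚ[_] {κ l} {κ m} (κ-↭ l↭m)

  edge⇒clique : ∀ {a b c} → edge H a b c ≡ true → cliqueᵇ (c ∷ a ∷ b ∷ []) ≡ true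
  edge⇒clique {a} {b} {c} e = trans (clique-∷ c (a ∷ b ∷ []))
    (∧-true⁺ (clique-pair (proj₁ (edge-distinct H a b c e))) (edge⇒extends a b c e))

  K₂-pos : ∀ {a b} → InShadow H a b → 0ℚ <ℚ K (a ∷ b ∷ [])
  K₂-pos {a} {b} sh = ℚ.<-≤-trans (subst (0ℚ <ℚ_) (identity N X) (ℚ.+-mono-<-≤ 0<N-6X (0≤+ 0≤X (0≤+ 0≤X (0≤+ 0≤X (0≤+ 0≤X 0≤X)))))) (K-pair-≥ sh)
    where
    identity : ∀ N X → N - (X + X + X + X + X + X) + (X + (X + (X + (X + X)))) ≡ N - X
    identity = solve-∀ ℚ-ring

  K₃-≥ : ∀ {a b c} → cliqueᵇ (c ∷ a ∷ b ∷ []) ≡ true → N - (X + X + X) ≤ℚ K (c ∷ a ∷ b ∷ [])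
  K₃-≥ {a} {b} {c} clq = ℚ.≤-trans (subst (_≤ℚ K (a ∷ b ∷ []) - (X + X)) (identity N X)
      (ℚ.+-monoˡ-≤ (- (X + X)) (K-pair-≥ (edge⇒shadow (edge-swap₂₃ (edge-swap₁₂ (clique-edge clq)))))))
    (K-triple-≥ clq)
    where
    identity : ∀ N X → N - X - (X + X) ≡ N - (X + X + X)
    identity = solve-∀ ℚ-ring

  K₃-pos : ∀ {a b c} → cliqueᵇ (a ∷ b ∷ c ∷ []) ≡ true → 0ℚ <ℚ K (a ∷ b ∷ c ∷ [])
  K₃-pos clq = ℚ.<-≤-trans (subst (0ℚ <ℚ_) (identity N X) (ℚ.+-mono-<-≤ 0<N-6X (0≤+ 0≤X (0≤+ 0≤X 0≤X)))) (K₃-≥ clq)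
    where
    identity : ∀ N X → N - (X + X + X + X + X + X) + (X + (X + X)) ≡ N - (X + X + X)
    identity = solve-∀ ℚ-ring

  -- By `K-quad-≥` the count is at least (N - 3X) + (N - X) - 2X - N = N - 6X.
  K₄-pos : ∀ {a b c d} → cliqueᵇ (d ∷ a ∷ b ∷ c ∷ []) ≡ true → 0ℚ <ℚ K (d ∷ a ∷ b ∷ c ∷ [])
  K₄-pos {a} {b} {c} {d} clq = ℚ.<-≤-trans (subst (0ℚ <ℚ_) (identity N X (K (a ∷ b ∷ c ∷ [])) (K (c ∷ d ∷ [])))
      (ℚ.+-mono-<-≤ 0<N-6X (0≤+ (≤⇒0≤- (K₃-≥ (clique-tail clq))) (≤⇒0≤- (K-pair-≥ (edge⇒shadow cda))))))
    (K-quad-≥ clq)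
    where
    cda : edge H c d a ≡ true
    cda = edge-swap₁₂ (edge-swap₂₃ (clique-edge (clique-perm (prep d (prep a (swap b c ↭-refl))) clq)))
    identity : ∀ N X k e → N - (X + X + X + X + X + X) + ((k - (N - (X + X + X))) + (e - (N - X))) ≡ k + e - (X + X) - N
    identity = solve-∀ ℚ-ring

  recipK : ∀ S → 0ℚ <ℚ K S → Reciprocal (K S) (inv (κ S))
  recipK S pos = inv-recip (ℚ-cancel-< {0} {κ S} pos)

  clique-∷ʳ : ∀ S v → 𝟙 (cliqueᵇ (S ∷ʳ v)) ≡ 𝟙 (cliqueᵇ S) * 𝟙 (extends S v)
  clique-∷ʳ S v = trans (cong 𝟙 (trans (clique-↭ (↭-sym (∷↭∷ʳ v S))) (clique-∷ v S))) (𝟙-∧ (cliqueᵇ S) (extends S v))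

  -- Each factor 1/κ(S) of the weight cancels against the number of extensions of S.
  telescope : ∀ S c → (cliqueᵇ S ≡ true → 0ℚ <ℚ K S) →
    Σᵥ (λ v → 𝟙 (cliqueᵇ (S ∷ʳ v)) * (c * inv (κ S))) ≡ 𝟙 (cliqueᵇ S) * c
  telescope S c pos = begin
    Σᵥ (λ v → 𝟙 (cliqueᵇ (S ∷ʳ v)) * (c * inv (κ S)))
      ≡⟨ Σ-*ʳ (c * inv (κ S)) (λ v → 𝟙 (cliqueᵇ (S ∷ʳ v))) ⟩
    Σᵥ (λ v → 𝟙 (cliqueᵇ (S ∷ʳ v))) * (c * inv (κ S))
      ≡⟨ cong (_* (c * inv (κ S))) (trans (Σ-cong (clique-∷ʳ S)) (trans (Σ-*ˡ (𝟙 (cliqueᵇ S)) (λ v → 𝟙 (extends S v))) (cong (𝟙 (cliqueᵇ S) *_) (Σ-count (extends S))))) ⟩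
    𝟙 (cliqueᵇ S) * K S * (c * inv (κ S))
      ≡⟨ go (cliqueᵇ S) pos ⟩
    𝟙 (cliqueᵇ S) * c ∎
    where
    open ≡-Reasoning
    regroup : ∀ k c i → 1ℚ * k * (c * i) ≡ 1ℚ * (c * (k * i))
    regroup = solve-∀ ℚ-ring
    vanish : ∀ k c i → 0ℚ * k * (c * i) ≡ 0ℚ * c
    vanish = solve-∀ ℚ-ring
    go : ∀ b → (b ≡ true → 0ℚ <ℚ K S) → 𝟙 b * K S * (c * inv (κ S)) ≡ 𝟙 b * c
    go false _   = vanish (K S) c (inv (κ S))
    go true  pos = trans (regroup (K S) c (inv (κ S)))
      (cong (1ℚ *_) (trans (cong (c *_) (Reciprocal.inverse (recipK S (pos refl)))) (ℚ.*-identityʳ c)))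

  Σ-mass₅ : ∀ a b c d → Σᵥ (λ v → mass a b c d v)
    ≡ 𝟙 (cliqueᵇ (a ∷ b ∷ c ∷ d ∷ [])) * (inv (κ (a ∷ b ∷ [])) * inv (κ (a ∷ b ∷ c ∷ [])))
  Σ-mass₅ a b c d = telescope (a ∷ b ∷ c ∷ d ∷ []) (inv (κ (a ∷ b ∷ [])) * inv (κ (a ∷ b ∷ c ∷ []))) K₄-pos

  Σ-mass₄ : ∀ a b c → Σᵥ (λ d → Σᵥ (λ v → mass a b c d v)) ≡ 𝟙 (cliqueᵇ (a ∷ b ∷ c ∷ [])) * inv (κ (a ∷ b ∷ []))
  Σ-mass₄ a b c = trans (Σ-cong (Σ-mass₅ a b c)) (telescope (a ∷ b ∷ c ∷ []) (inv (κ (a ∷ b ∷ []))) K₃-pos)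

  Σ-mass₃ : ∀ {a b} → InShadow H a b → Σᵥ (λ c → Σᵥ (λ d → Σᵥ (λ v → mass a b c d v))) ≡ 1ℚ
  Σ-mass₃ {a} {b} sh = trans (Σ-cong (Σ-mass₄ a b))
    (trans (Σ-cong λ c → cong (𝟙 (cliqueᵇ (a ∷ b ∷ c ∷ [])) *_) (sym (ℚ.*-identityˡ (inv (κ (a ∷ b ∷ []))))))
      (trans (telescope (a ∷ b ∷ []) 1ℚ (λ _ → K₂-pos sh))
        (cong (λ t → 𝟙 t * 1ℚ) (clique-pair (proj₁ sh)))))

  Σ₂ : (Fin n → Fin n → ℚ) → ℚ
  Σ₂ f = Σᵥ λ u → Σᵥ λ v → f u v

  Σ₂-cong : ∀ {f g} → (∀ u v → f u v ≡ g u v) → Σ₂ f ≡ Σ₂ g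
  Σ₂-cong eq = Σ-cong λ u → Σ-cong (eq u)

  Σ₂-+ : ∀ f g → Σ₂ (λ u v → f u v + g u v) ≡ Σ₂ f + Σ₂ g
  Σ₂-+ f g = trans (Σ-cong λ u → Σ-+ (f u) (g u)) (Σ-+ (λ u → Σᵥ (f u)) (λ u → Σᵥ (g u)))

  Σ₂-+₃ : ∀ f g h → Σ₂ (λ u v → f u v + (g u v + h u v)) ≡ Σ₂ f + (Σ₂ g + Σ₂ h)
  Σ₂-+₃ f g h = trans (Σ₂-+ f (λ u v → g u v + h u v)) (cong (Σ₂ f +_) (Σ₂-+ g h))

  6X≤N : X + X + X + X + X + X ≤ℚ N
  6X≤N = 0≤-⇒≤ (ℚ.<⇒≤ 0<N-6X)

  0<N-2X : 0ℚ <ℚ N - (X + X)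
  0<N-2X = subst (0ℚ <ℚ_) (identity N X) (ℚ.+-mono-<-≤ 0<N-6X (0≤+ 0≤X (0≤+ 0≤X (0≤+ 0≤X 0≤X))))
    where
    identity : ∀ N X → N - (X + X + X + X + X + X) + (X + (X + (X + X))) ≡ N - (X + X)
    identity = solve-∀ ℚ-ring

  0<N-X : 0ℚ <ℚ N - X
  0<N-X = subst (0ℚ <ℚ_) (identity N X) (ℚ.+-mono-<-≤ 0<N-2X 0≤X)
    where
    identity : ∀ N X → N - (X + X) + X ≡ N - X
    identity = solve-∀ ℚ-ring

  open Extremal {N} {X} 0≤X 6X≤N 0<N-2X (proj₂ (proj₁ (proj₂ deficit)))

  iN iP iR : ℚ
  iN = inv n
  iP = proj₁ (reciprocal 0<N-X)
  iR = proj₁ (reciprocal 0<N-2X)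

  rN : Reciprocal N iN
  rN = inv-recip 0<n

  rP : Reciprocal P iP
  rP = proj₂ (reciprocal 0<N-X)

  rR : Reciprocal R iR
  rR = proj₂ (reciprocal 0<N-2X)

  -- Nonnegativity of w_H(O): gains, losses and the budget 1/K(x, y)

  module Nonnegativity {x y z : Fin n} (xyz : edge H x y z ≡ true) where

    iD : ℚ
    iD = inv (κ (x ∷ y ∷ []))

    -- The two shares of the budget per vertex u: X/(P R) and C/(N P R) times 1/K(x, y). As C = P R
    -- - X N, the N vertices u use up exactly 1/K(x, y).
    c₁ c₂ : ℚ
    c₁ = iD * (X * (iP * iR))
    c₂ = iD * (iN * (C * (iP * iR)))

    0≤iD : 0ℚ ≤ℚ iD
    0≤iD = 0≤inv (κ (x ∷ y ∷ []))

    0≤iPiR : 0ℚ ≤ℚ iP * iR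
    0≤iPiR = 0≤* (Reciprocal.nonneg rP) (Reciprocal.nonneg rR)

    0≤c₁ : 0ℚ ≤ℚ c₁
    0≤c₁ = 0≤* 0≤iD (0≤* 0≤X 0≤iPiR)

    0≤c₂ : 0ℚ ≤ℚ c₂
    0≤c₂ = 0≤* 0≤iD (0≤* (0≤inv n) (0≤* 0≤C 0≤iPiR))

    N*[c₁+c₂]≡iD : N * (c₁ + c₂) ≡ iD
    N*[c₁+c₂]≡iD = trans (regroup N X iD iN (P * R) (iP * iR))
      (trans (cong (λ s → iD * (X * N * (iP * iR) + s * (P * R * (iP * iR) - X * N * (iP * iR)))) (Reciprocal.inverse rN))
        (trans (cong (λ t → iD * (X * N * (iP * iR) + 1ℚ * (t - X * N * (iP * iR)))) (Reciprocal.inverse (recip-* rP rR)))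
          (collapse iD (X * N * (iP * iR)))))
      where
      regroup : ∀ N X iD iN Q i → N * (iD * (X * i) + iD * (iN * ((Q - X * N) * i)))
        ≡ iD * (X * N * i + N * iN * (Q * i - X * N * i))
      regroup = solve-∀ ℚ-ring
      collapse : ∀ iD t → iD * (t + 1ℚ * (1ℚ - t)) ≡ iD
      collapse = solve-∀ ℚ-ring

    module _ (u v : Fin n) where
      ρ : Bool
      ρ = cliqueᵇ (x ∷ y ∷ z ∷ u ∷ v ∷ [])

      i₁ ie ia ib ik ik′ : ℚ
      i₁  = inv (κ (x ∷ u ∷ []))
      ie  = inv (κ (u ∷ v ∷ []))
      ia  = inv (κ (x ∷ y ∷ u ∷ []))
      ib  = inv (κ (x ∷ u ∷ v ∷ []))
      ik  = inv (κ (x ∷ y ∷ u ∷ v ∷ []))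
      ik′ = inv (κ (x ∷ y ∷ z ∷ u ∷ []))

      -- The masses of the arrangements with x, y, z at the indexed positions and u before v at the
      -- free ones. With this naming all of them share the indicator `ρ`, and `g₁₂₄`, `g₁₂₅`, `g₃₄₅`
      -- differ from `g₁₃₄`, `g₁₃₅`, `g₁₄₅` respectively in one factor.
      g₁₂₄ g₁₃₄ g₁₂₅ g₁₃₅ g₁₄₅ g₃₄₅ : ℚ
      g₁₂₄ = 𝟙 ρ * (iD * ia * ik′)
      g₁₃₄ = 𝟙 ρ * (i₁ * ia * ik′)
      g₁₂₅ = 𝟙 ρ * (iD * ia * ik)
      g₁₃₅ = 𝟙 ρ * (i₁ * ia * ik)
      g₁₄₅ = 𝟙 ρ * (i₁ * ib * ik)
      g₃₄₅ = 𝟙 ρ * (ie * ib * ik)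

      mass-↭ : ∀ {v₁ v₂ v₃ v₄ v₅ S T U} → v₁ ∷ v₂ ∷ v₃ ∷ v₄ ∷ v₅ ∷ [] ↭ x ∷ y ∷ z ∷ u ∷ v ∷ [] →
        v₁ ∷ v₂ ∷ [] ↭ S → v₁ ∷ v₂ ∷ v₃ ∷ [] ↭ T → v₁ ∷ v₂ ∷ v₃ ∷ v₄ ∷ [] ↭ U →
        mass v₁ v₂ v₃ v₄ v₅ ≡ 𝟙 ρ * (inv (κ S) * inv (κ T) * inv (κ U))
      mass-↭ p q r s = cong₂ _*_ (cong 𝟙 (clique-↭ p))
        (cong₂ _*_ (cong₂ _*_ (cong inv (κ-↭ q)) (cong inv (κ-↭ r))) (cong inv (κ-↭ s)))

      mass₁₂₄ : mass x y u z v ≡ g₁₂₄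
      mass₁₂₄ = mass-↭ (prep x (prep y (swap u z ↭-refl))) ↭-refl ↭-refl (prep x (prep y (swap u z ↭-refl)))

      mass₁₃₄ : mass x u y z v ≡ g₁₃₄
      mass₁₃₄ = mass-↭ (prep x (↭-trans (swap u y ↭-refl) (prep y (swap u z ↭-refl)))) ↭-refl
        (prep x (swap u y ↭-refl)) (prep x (++-comm (u ∷ []) (y ∷ z ∷ [])))

      mass₂₃₄ : mass u x y z v ≡ g₁₃₄
      mass₂₃₄ = mass-↭ (↭-trans (swap u x ↭-refl) (prep x (↭-trans (swap u y ↭-refl) (prep y (swap u z ↭-refl)))))
        (swap u x ↭-refl) (++-comm (u ∷ []) (x ∷ y ∷ [])) (++-comm (u ∷ []) (x ∷ y ∷ z ∷ []))

      mass₁₂₅ : mass x y u v z ≡ g₁₂₅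
      mass₁₂₅ = mass-↭ (prep x (prep y (++-comm (u ∷ v ∷ []) (z ∷ [])))) ↭-refl ↭-refl ↭-refl

      mass₁₃₅ : mass x u y v z ≡ g₁₃₅
      mass₁₃₅ = mass-↭ (prep x (↭-trans (swap u y ↭-refl) (prep y (++-comm (u ∷ v ∷ []) (z ∷ [])))))
        ↭-refl (prep x (swap u y ↭-refl)) (prep x (swap u y ↭-refl))

      mass₂₃₅ : mass u x y v z ≡ g₁₃₅
      mass₂₃₅ = mass-↭ (↭-trans (swap u x ↭-refl) (prep x (↭-trans (swap u y ↭-refl) (prep y (++-comm (u ∷ v ∷ []) (z ∷ []))))))
        (swap u x ↭-refl) (++-comm (u ∷ []) (x ∷ y ∷ [])) (↭-trans (swap u x ↭-refl) (prep x (swap u y ↭-refl)))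

      mass₁₄₅ : mass x u v y z ≡ g₁₄₅
      mass₁₄₅ = mass-↭ (prep x (++-comm (u ∷ v ∷ []) (y ∷ z ∷ []))) ↭-refl ↭-refl (prep x (++-comm (u ∷ v ∷ []) (y ∷ [])))

      mass₂₄₅ : mass u x v y z ≡ g₁₄₅
      mass₂₄₅ = mass-↭ (↭-trans (swap u x ↭-refl) (prep x (++-comm (u ∷ v ∷ []) (y ∷ z ∷ []))))
        (swap u x ↭-refl) (swap u x ↭-refl) (↭-trans (swap u x ↭-refl) (prep x (++-comm (u ∷ v ∷ []) (y ∷ []))))

      mass₃₄₅ : mass u v x y z ≡ g₃₄₅
      mass₃₄₅ = mass-↭ (++-comm (u ∷ v ∷ []) (x ∷ y ∷ z ∷ [])) ↭-refl (++-comm (u ∷ v ∷ []) (x ∷ []))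
        (++-comm (u ∷ v ∷ []) (x ∷ y ∷ []))

      -- Its sum over u and v is at most 1/κ(x, y).
      bound : ℚ
      bound = c₁ * (𝟙 (extends (x ∷ y ∷ z ∷ u ∷ []) v) * ik′)
            + c₂ * (𝟙 (extends (x ∷ y ∷ u ∷ []) v) * ia)

      0≤bound : 0ℚ ≤ℚ bound
      0≤bound = 0≤+
        (0≤* 0≤c₁ (0≤* (0≤𝟙 (extends (x ∷ y ∷ z ∷ u ∷ []) v)) (0≤inv (κ (x ∷ y ∷ z ∷ u ∷ [])))))
        (0≤* 0≤c₂ (0≤* (0≤𝟙 (extends (x ∷ y ∷ u ∷ []) v)) (0≤inv (κ (x ∷ y ∷ u ∷ [])))))

      -- On a clique both indicators in `bound` are 1. The claim is then `four` multiplied by `ik′`,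
      -- added to `five`.
      clique-bound : ρ ≡ true →
        i₁ * ia * ik′ + (i₁ * ia * ik + i₁ * ib * ik) ≤ℚ bound + (iD * ia * ik′ + (iD * ia * ik + ie * ib * ik))
      clique-bound clq = subst (λ t → i₁ * ia * ik′ + (i₁ * ia * ik + i₁ * ib * ik) ≤ℚ t + (iD * ia * ik′ + (iD * ia * ik + ie * ib * ik)))
        (sym (cong₂ (λ s t → c₁ * (𝟙 s * ik′) + c₂ * (𝟙 t * ia)) ext₄ ext₃))
        (0≤-⇒≤ (subst (0ℚ ≤ℚ_) (identity c₁ c₂ iD i₁ ie ia ib ik ik′)
          (0≤+ (0≤* (≤⇒0≤- four) (0≤inv (κ (x ∷ y ∷ z ∷ u ∷ [])))) (≤⇒0≤- five))))
        where
        vxyzu : cliqueᵇ (v ∷ x ∷ y ∷ z ∷ u ∷ []) ≡ true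
        vxyzu = clique-perm (↭-sym (∷↭∷ʳ v (x ∷ y ∷ z ∷ u ∷ []))) clq
        zvxyu : cliqueᵇ (z ∷ v ∷ x ∷ y ∷ u ∷ []) ≡ true
        zvxyu = clique-perm (↭-trans (prep v (prep x (swap y z ↭-refl)))
          (↭-trans (prep v (swap x z ↭-refl)) (swap v z ↭-refl))) vxyzu
        vxyu : cliqueᵇ (v ∷ x ∷ y ∷ u ∷ []) ≡ true
        vxyu = clique-tail zvxyu
        uxy : cliqueᵇ (u ∷ x ∷ y ∷ []) ≡ true
        uxy = clique-perm (↭-sym (∷↭∷ʳ u (x ∷ y ∷ []))) (clique-tail vxyu)
        yxuv : cliqueᵇ (y ∷ x ∷ u ∷ v ∷ []) ≡ true
        yxuv = clique-perm (↭-trans (∷↭∷ʳ v (x ∷ y ∷ u ∷ [])) (swap x y ↭-refl)) vxyu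
        xuv : cliqueᵇ (x ∷ u ∷ v ∷ []) ≡ true
        xuv = clique-tail yxuv
        ext₄ : extends (x ∷ y ∷ z ∷ u ∷ []) v ≡ true
        ext₄ = clique-extends vxyzu
        ext₃ : extends (x ∷ y ∷ u ∷ []) v ≡ true
        ext₃ = clique-extends vxyu
        xy : InShadow H x y
        xy = edge⇒shadow xyz
        xu : InShadow H x u
        xu = edge⇒shadow (clique-edge xuv)
        uv : InShadow H u v
        uv = edge⇒shadow (edge-swap₂₃ (edge-swap₁₂ (clique-edge xuv)))
        a≥ : K (x ∷ y ∷ []) - (X + X) ≤ℚ K (x ∷ y ∷ u ∷ [])
        a≥ = subst (K (x ∷ y ∷ []) - (X + X) ≤ℚ_) (K-↭ (∷↭∷ʳ u (x ∷ y ∷ []))) (K-triple-≥ uxy)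
        k≥ : K (x ∷ y ∷ u ∷ []) + K (u ∷ v ∷ []) - (X + X) - N ≤ℚ K (x ∷ y ∷ u ∷ v ∷ [])
        k≥ = subst (K (x ∷ y ∷ u ∷ []) + K (u ∷ v ∷ []) - (X + X) - N ≤ℚ_) (K-↭ (∷↭∷ʳ v (x ∷ y ∷ u ∷ []))) (K-quad-≥ vxyu)
        rD = recipK (x ∷ y ∷ []) (K₂-pos xy)
        r₁ = recipK (x ∷ u ∷ []) (K₂-pos xu)
        ra = recipK (x ∷ y ∷ u ∷ []) (K₃-pos (clique-tail vxyu))
        open Degree {K (x ∷ y ∷ [])} {K (x ∷ u ∷ [])} {K (x ∷ y ∷ u ∷ [])} (K≤N (x ∷ y ∷ [])) (K-pair-≥ xy) (K-pair-≥ xu) a≥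
        open Pair {K (u ∷ v ∷ [])} {K (x ∷ u ∷ v ∷ [])} {K (x ∷ y ∷ u ∷ v ∷ [])} (K≤N (u ∷ v ∷ [])) (K-pair-≥ uv) (K-triple-≥ xuv) k≥
        four : (i₁ - iD) * ia ≤ℚ c₁
        four = four-clique-weight rP rR rD r₁ ra
        five : ((i₁ - iD) * ia + (i₁ - ie) * ib) * ik ≤ℚ ia * c₂
        five = five-clique-weight rN rP rR rD r₁ ra (recipK (u ∷ v ∷ []) (K₂-pos uv)) (recipK (x ∷ u ∷ v ∷ []) (K₃-pos xuv))
          (recipK (x ∷ y ∷ u ∷ v ∷ []) (K₄-pos (clique-perm (swap y x ↭-refl) yxuv)))
        identity : ∀ c₁ c₂ iD i₁ ie ia ib ik ik′ →
          (c₁ - (i₁ - iD) * ia) * ik′ + (ia * c₂ - ((i₁ - iD) * ia + (i₁ - ie) * ib) * ik)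
          ≡ (c₁ * (1ℚ * ik′) + c₂ * (1ℚ * ia)) + (iD * ia * ik′ + (iD * ia * ik + ie * ib * ik))
            - (i₁ * ia * ik′ + (i₁ * ia * ik + i₁ * ib * ik))
        identity = solve-∀ ℚ-ring

      -- Off the cliques gains and losses vanish and `0≤bound` suffices.
      pointwise : g₁₃₄ + (g₁₃₅ + g₁₄₅) ≤ℚ bound + (g₁₂₄ + (g₁₂₅ + g₃₄₅))
      pointwise = scale ρ (i₁ * ia * ik′) (i₁ * ia * ik) (i₁ * ib * ik)
          (iD * ia * ik′) (iD * ia * ik) (ie * ib * ik) clique-bound
        where
        scale : ∀ b p q r s t w → (b ≡ true → p + (q + r) ≤ℚ bound + (s + (t + w))) →
          𝟙 b * p + (𝟙 b * q + 𝟙 b * r) ≤ℚ bound + (𝟙 b * s + (𝟙 b * t + 𝟙 b * w))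
        scale true p q r s t w h = subst₂ _≤ℚ_ (units p q r) (cong (bound +_) (units s t w)) (h refl)
          where
          units : ∀ p q r → p + (q + r) ≡ 1ℚ * p + (1ℚ * q + 1ℚ * r)
          units = solve-∀ ℚ-ring
        scale false p q r s t w h = subst₂ _≤ℚ_ (zeros p q r)
            (trans (sym (ℚ.+-identityʳ bound)) (cong (bound +_) (zeros s t w))) 0≤bound
          where
          zeros : ∀ p q r → 0ℚ ≡ 0ℚ * p + (0ℚ * q + 0ℚ * r)
          zeros = solve-∀ ℚ-ring

    -- Only an inequality, since u is an arbitrary vertex and S need not be a clique: the count may
    -- be 0, and then `inv` is 0 as well.
    Σ-extends-≤ : ∀ S → Σᵥ (λ v → 𝟙 (extends S v) * inv (κ S)) ≤ℚ 1ℚ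
    Σ-extends-≤ S = subst (_≤ℚ 1ℚ)
      (sym (trans (Σ-*ʳ (inv (κ S)) (λ v → 𝟙 (extends S v))) (cong (_* inv (κ S)) (Σ-count (extends S)))))
      (ℚ*inv≤1 (κ S))

    -- For fixed u the two normalised sums over v are at most 1, which leaves c₁ + c₂; then u runs
    -- over n vertices.
    Σ₂-bound : Σ₂ bound ≤ℚ iD
    Σ₂-bound = subst (Σ₂ bound ≤ℚ_) (trans (Σ-const n (c₁ + c₂)) N*[c₁+c₂]≡iD) (Σ-mono inner)
      where
      inner : ∀ u → Σᵥ (bound u) ≤ℚ c₁ + c₂
      inner u = subst₂ _≤ℚ_
        (sym (trans (Σ-+ (λ v → c₁ * f v) (λ v → c₂ * g v)) (cong₂ _+_ (Σ-*ˡ c₁ f) (Σ-*ˡ c₂ g))))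
        (cong₂ _+_ (ℚ.*-identityʳ c₁) (ℚ.*-identityʳ c₂))
        (ℚ.+-mono-≤ (*-monoˡ-0≤ {Σᵥ f} {1ℚ} 0≤c₁ (Σ-extends-≤ (x ∷ y ∷ z ∷ u ∷ [])))
                    (*-monoˡ-0≤ {Σᵥ g} {1ℚ} 0≤c₂ (Σ-extends-≤ (x ∷ y ∷ u ∷ []))))
        where
        f g : Fin n → ℚ
        f v = 𝟙 (extends (x ∷ y ∷ z ∷ u ∷ []) v) * ik′ u v
        g v = 𝟙 (extends (x ∷ y ∷ u ∷ []) v) * ia u v

    A₁₂₃ : Σ₂ (λ u v → mass x y z u v) ≡ iD
    A₁₂₃ = trans (Σ-mass₄ x y z)
      (trans (cong (λ b → 𝟙 b * iD) (clique-perm (∷↭∷ʳ z (x ∷ y ∷ [])) (edge⇒clique xyz))) (ℚ.*-identityˡ iD))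

    gain loss : ℚ
    gain = Σ₂ g₁₂₄ + (Σ₂ g₁₂₅ + Σ₂ g₃₄₅)
    loss = Σ₂ g₁₃₄ + (Σ₂ g₁₃₅ + Σ₂ g₁₄₅)

    loss≤ : loss ≤ℚ iD + gain
    loss≤ = ℚ.≤-trans
      (subst₂ _≤ℚ_ (Σ₂-+₃ g₁₃₄ g₁₃₅ g₁₄₅)
        (trans (Σ₂-+ bound (λ u v → g₁₂₄ u v + (g₁₂₅ u v + g₃₄₅ u v))) (cong (Σ₂ bound +_) (Σ₂-+₃ g₁₂₄ g₁₂₅ g₃₄₅)))
        (Σ-mono λ u → Σ-mono (pointwise u)))
      (ℚ.+-monoˡ-≤ gain Σ₂-bound)

    wO≡ : wO H x y z ≡ (ℤ.+ 1 / 6) * (iD + gain - loss)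
    wO≡ = trans (wO-expansion x≢y y≢z x≢z)
      (trans (cong₁₀ A₁₂₃ (Σ₂-cong mass₁₂₄) (Σ₂-cong mass₁₂₅) (Σ₂-cong mass₁₃₄) (Σ₂-cong mass₁₃₅) (Σ₂-cong mass₁₄₅)
                (Σ₂-cong mass₂₃₄) (Σ₂-cong mass₂₃₅) (Σ₂-cong mass₂₄₅) (Σ₂-cong mass₃₄₅))
        (identity iD (Σ₂ g₁₂₄) (Σ₂ g₁₂₅) (Σ₂ g₁₃₄) (Σ₂ g₁₃₅) (Σ₂ g₁₄₅) (Σ₂ g₃₄₅)))
      where
      x≢y = proj₁ (edge-distinct H x y z xyz)
      y≢z = proj₁ (proj₂ (edge-distinct H x y z xyz))
      x≢z = proj₂ (proj₂ (edge-distinct H x y z xyz))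
      signed : ℚ → ℚ → ℚ → ℚ → ℚ → ℚ → ℚ → ℚ → ℚ → ℚ → ℚ
      signed a b c d e f g h i j = ½ * ((ℤ.+ 1 / 3) * a + ((ℤ.+ 1 / 3) * b + ((ℤ.+ 1 / 3) * c
        + ((ℤ.-[1+ 0 ] / 6) * d + ((ℤ.-[1+ 0 ] / 6) * e + ((ℤ.-[1+ 0 ] / 6) * f
        + ((ℤ.-[1+ 0 ] / 6) * g + ((ℤ.-[1+ 0 ] / 6) * h + ((ℤ.-[1+ 0 ] / 6) * i + ((ℤ.+ 1 / 3) * j + 0ℚ))))))))))
      cong₁₀ : ∀ {a b c d e f g h i j a′ b′ c′ d′ e′ f′ g′ h′ i′ j′} →
        a ≡ a′ → b ≡ b′ → c ≡ c′ → d ≡ d′ → e ≡ e′ → f ≡ f′ → g ≡ g′ → h ≡ h′ → i ≡ i′ → j ≡ j′ →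
        signed a b c d e f g h i j ≡ signed a′ b′ c′ d′ e′ f′ g′ h′ i′ j′
      cong₁₀ refl refl refl refl refl refl refl refl refl refl = refl
      identity : ∀ a b c d e f j → ½ * ((ℤ.+ 1 / 3) * a + ((ℤ.+ 1 / 3) * b + ((ℤ.+ 1 / 3) * c
        + ((ℤ.-[1+ 0 ] / 6) * d + ((ℤ.-[1+ 0 ] / 6) * e + ((ℤ.-[1+ 0 ] / 6) * f
        + ((ℤ.-[1+ 0 ] / 6) * d + ((ℤ.-[1+ 0 ] / 6) * e + ((ℤ.-[1+ 0 ] / 6) * f + ((ℤ.+ 1 / 3) * j + 0ℚ))))))))))
        ≡ (ℤ.+ 1 / 6) * (a + (b + (c + j)) - (d + (e + f)))
      identity = solve-∀ ℚ-ring

    wO-nonneg : 0ℚ ≤ℚ wO H x y z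
    wO-nonneg = subst (0ℚ ≤ℚ_) (sym wO≡) (0≤* (ℚ.nonNegative⁻¹ (ℤ.+ 1 / 6)) (≤⇒0≤- loss≤))

-- Summation over the orderings of an edge, and the degrees of w_H

module Totals {n : ℕ} (H : Hypergraph3 n) where
  open Cliques H
  open Expansion H

  module _ {x y z : Fin n} (x≢y : x ≢ y) (y≢z : y ≢ z) (x≢z : x ≢ z) where

    wE-orderings : wE H x y z ≡ wO H x y z + (wO H x z y + (wO H y x z + (wO H y z x + (wO H z x y + wO H z y x))))
    wE-orderings = trans (cong (½ *_) (trans (Σ₅-cong pointwise)
        (split (F x y z) (F x z y) (F y x z) (F y z x) (F z x y) (F z y x))))
      (distribute ½ (Σ₅ (F x y z)) (Σ₅ (F x z y)) (Σ₅ (F y x z)) (Σ₅ (F y z x)) (Σ₅ (F z x y)) (Σ₅ (F z y x)))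
      where
      F : (a b c v₁ v₂ v₃ v₄ v₅ : Fin n) → ℚ
      F a b c v₁ v₂ v₃ v₄ v₅ = if isOrd5Cliqueᵇ H v₁ v₂ v₃ v₄ v₅ ∧ subseqᵇ (a ∷ b ∷ c ∷ []) (v₁ ∷ v₂ ∷ v₃ ∷ v₄ ∷ v₅ ∷ [])
        then W₄ H v₁ v₂ v₃ v₄ * ψK v₁ v₂ v₃ v₄ v₅ a b c else 0ℚ
      distribute : ∀ h a b c d e f → h * (a + (b + (c + (d + (e + f))))) ≡ h * a + (h * b + (h * c + (h * d + (h * e + h * f))))
      distribute = solve-∀ ℚ-ring
      split : ∀ a b c d e f →
        Σ₅ (λ v₁ v₂ v₃ v₄ v₅ → a v₁ v₂ v₃ v₄ v₅ + (b v₁ v₂ v₃ v₄ v₅ + (c v₁ v₂ v₃ v₄ v₅ + (d v₁ v₂ v₃ v₄ v₅ + (e v₁ v₂ v₃ v₄ v₅ + f v₁ v₂ v₃ v₄ v₅)))))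
        ≡ Σ₅ a + (Σ₅ b + (Σ₅ c + (Σ₅ d + (Σ₅ e + Σ₅ f))))
      split a b c d e f =
        trans (Σ₅-+ a (λ v₁ v₂ v₃ v₄ v₅ → b v₁ v₂ v₃ v₄ v₅ + (c v₁ v₂ v₃ v₄ v₅ + (d v₁ v₂ v₃ v₄ v₅ + (e v₁ v₂ v₃ v₄ v₅ + f v₁ v₂ v₃ v₄ v₅)))))
        (cong (Σ₅ a +_) (trans (Σ₅-+ b (λ v₁ v₂ v₃ v₄ v₅ → c v₁ v₂ v₃ v₄ v₅ + (d v₁ v₂ v₃ v₄ v₅ + (e v₁ v₂ v₃ v₄ v₅ + f v₁ v₂ v₃ v₄ v₅))))
        (cong (Σ₅ b +_) (trans (Σ₅-+ c (λ v₁ v₂ v₃ v₄ v₅ → d v₁ v₂ v₃ v₄ v₅ + (e v₁ v₂ v₃ v₄ v₅ + f v₁ v₂ v₃ v₄ v₅)))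
        (cong (Σ₅ c +_) (trans (Σ₅-+ d (λ v₁ v₂ v₃ v₄ v₅ → e v₁ v₂ v₃ v₄ v₅ + f v₁ v₂ v₃ v₄ v₅))
        (cong (Σ₅ d +_) (Σ₅-+ e f))))))))
      pointwise : ∀ v₁ v₂ v₃ v₄ v₅ → _ ≡ F x y z v₁ v₂ v₃ v₄ v₅ + (F x z y v₁ v₂ v₃ v₄ v₅ + (F y x z v₁ v₂ v₃ v₄ v₅
        + (F y z x v₁ v₂ v₃ v₄ v₅ + (F z x y v₁ v₂ v₃ v₄ v₅ + F z y x v₁ v₂ v₃ v₄ v₅))))
      pointwise v₁ v₂ v₃ v₄ v₅ = trans (wE-integrand v₁ v₂ v₃ v₄ v₅ x y z)
        (trans (mass-cong v₁ v₂ v₃ v₄ v₅ λ clq → on-codes {vs = vs} (clique-distinct clq) x≢y y≢z x≢z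
            (λ r s t → ψᵣ r s t ≡ ψ-inOrder r s t + (ψ-inOrder r t s + (ψ-inOrder s r t + (ψ-inOrder s t r + (ψ-inOrder t r s + ψ-inOrder t s r)))))
            ψ-orderings)
          (trans (distribute (mass v₁ v₂ v₃ v₄ v₅) (ω x y z) (ω x z y) (ω y x z) (ω y z x) (ω z x y) (ω z y x))
            (sym (cong₂ _+_ (I x y z) (cong₂ _+_ (I x z y) (cong₂ _+_ (I y x z) (cong₂ _+_ (I y z x) (cong₂ _+_ (I z x y) (I z y x)))))))))
        where
        vs = v₁ ∷ v₂ ∷ v₃ ∷ v₄ ∷ v₅ ∷ []
        ω : Fin n → Fin n → Fin n → ℚ
        ω a b c = ψ-inOrder (row vs a) (row vs b) (row vs c)
        I : ∀ a b c → F a b c v₁ v₂ v₃ v₄ v₅ ≡ mass v₁ v₂ v₃ v₄ v₅ * ω a b c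
        I = wO-integrand v₁ v₂ v₃ v₄ v₅

  clique-edges : ∀ {m} (vs : Vec (Fin n) m) → cliqueᵇ (Vec.toList vs) ≡ true → ∀ j k i → j ≢ k →
    edge H (lookup vs j) (lookup vs k) (lookup vs i) ≡ not (suc j == suc i) ∧ not (suc k == suc i)
  clique-edges vs clq j k i j≢k with suc j Fin.≟ suc i | suc k Fin.≟ suc i
  ... | yes refl | _        = bool-ext (λ e → contradiction refl (proj₂ (proj₂ (edge-distinct H _ _ _ e)))) λ ()
  ... | no _     | yes refl = bool-ext (λ e → contradiction refl (proj₁ (proj₂ (edge-distinct H _ _ _ e)))) λ ()
  ... | no j≢i   | no k≢i   = clique-sound clq (lookup-∈ vs j) (lookup-∈ vs k) (lookup-∈ vs i)
    (j≢k ∘ inj j k) (k≢i ∘ cong suc ∘ inj k i) (j≢i ∘ cong suc ∘ inj j i)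
    where
    inj = lookup-injective vs (clique-distinct clq)

  module _ {a b : Fin n} (a≢b : a ≢ b) where

    -- If a or b is absent from the clique, both sides vanish because ψ does. If both are present,
    -- every third clique vertex completes an edge, so the positions decide.
    edge-on-clique : ∀ (vs : Vec (Fin n) 5) → cliqueᵇ (Vec.toList vs) ≡ true → (p : Located vs a) (q : Located vs b) → ∀ i →
      𝟙 (edge H a b (lookup vs i)) * ψᵣ (code (position p)) (code (position q)) (code (suc i))
        ≡ 𝟙 (not (position p == suc i) ∧ not (position q == suc i)) * ψᵣ (code (position p)) (code (position q)) (code (suc i))
    edge-on-clique vs clq (located zero _ _) q i =
      trans (ℚ.*-zeroʳ (𝟙 (edge H a b (lookup vs i)))) (sym (ℚ.*-zeroʳ (𝟙 (not (zero {5} == suc i) ∧ not (position q == suc i)))))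
    edge-on-clique vs clq (located (suc j) _ _) (located zero _ _) i rewrite ψ-absent (suc j) i =
      trans (ℚ.*-zeroʳ (𝟙 (edge H a b (lookup vs i)))) (sym (ℚ.*-zeroʳ (𝟙 (not (suc j == suc i) ∧ not (zero {5} == suc i)))))
    edge-on-clique vs clq (located (suc j) _ a≡) (located (suc k) _ b≡) i =
      cong (λ t → 𝟙 t * ψᵣ (code (suc j)) (code (suc k)) (code (suc i)))
        (trans (cong₂ (λ s t → edge H s t (lookup vs i)) (a≡ j refl) (b≡ k refl))
          (clique-edges vs clq j k i λ { refl → a≢b (trans (a≡ j refl) (sym (b≡ j refl))) }))

    -- By `ψ-third` and an exchange of sums, c runs over the five clique vertices only, where edges
    -- are read off from positions and `ψ-pair-sum` applies.
    ψ-degree : ∀ (vs : Vec (Fin n) 5) → cliqueᵇ (Vec.toList vs) ≡ true →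
      Σᵥ (λ c → 𝟙 (edge H a b c) * ψᵣ (row vs a) (row vs b) (row vs c))
        ≡ 𝟙 (a == lookup vs (# 0)) * 𝟙 (b == lookup vs (# 1)) + 𝟙 (b == lookup vs (# 0)) * 𝟙 (a == lookup vs (# 1))
    ψ-degree vs clq = begin
      Σᵥ (λ c → 𝟙 (edge H a b c) * ψᵣ (row vs a) (row vs b) (row vs c))
        ≡⟨ Σ-cong (λ c → trans (cong (𝟙 (edge H a b c) *_) (third c)) (sym (Σ-*ˡ (𝟙 (edge H a b c)) (λ i → 𝟙 (c == lookup vs i) * t i)))) ⟩
      Σᵥ (λ c → Σᵥ λ i → 𝟙 (edge H a b c) * (𝟙 (c == lookup vs i) * t i))
        ≡⟨ Σ-swap (λ c i → 𝟙 (edge H a b c) * (𝟙 (c == lookup vs i) * t i)) ⟩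
      Σᵥ (λ i → Σᵥ λ c → 𝟙 (edge H a b c) * (𝟙 (c == lookup vs i) * t i))
        ≡⟨ Σ-cong (λ i → trans (Σ-cong λ c → trans (exchange (𝟙 (edge H a b c)) (𝟙 (c == lookup vs i)) (t i))
              (cong (λ s → 𝟙 s * (𝟙 (edge H a b c) * t i)) (==-sym c (lookup vs i))))
            (Σ-select (lookup vs i) (λ c → 𝟙 (edge H a b c) * t i))) ⟩
      Σᵥ (λ i → 𝟙 (edge H a b (lookup vs i)) * t i)
        ≡⟨ Σ-cong (edge-on-clique vs clq pa pb) ⟩
      Σᵥ (λ i → 𝟙 (not (position pa == suc i) ∧ not (position pb == suc i)) * t i)
        ≡⟨ ψ-pair-sum (position pa) (position pb) (compatible-≢ a≢b pa pb) ⟩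
      𝟙 (lookup (code (position pa)) (# 0)) * 𝟙 (lookup (code (position pb)) (# 1)) + 𝟙 (lookup (code (position pb)) (# 0)) * 𝟙 (lookup (code (position pa)) (# 1))
        ≡⟨ cong₂ _+_ (cong₂ _*_ (entry pa (# 0)) (entry pb (# 1))) (cong₂ _*_ (entry pb (# 0)) (entry pa (# 1))) ⟩
      𝟙 (a == lookup vs (# 0)) * 𝟙 (b == lookup vs (# 1)) + 𝟙 (b == lookup vs (# 0)) * 𝟙 (a == lookup vs (# 1)) ∎
      where
      open ≡-Reasoning
      at : ∀ u → Located vs u
      at = locate vs (clique-distinct clq)
      pa = at a
      pb = at b
      t : Fin 5 → ℚ
      t i = ψᵣ (code (position pa)) (code (position pb)) (code (suc i))
      entry : ∀ {u} (p : Located vs u) i → 𝟙 (lookup (code (position p)) i) ≡ 𝟙 (u == lookup vs i)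
      entry {u} p i = cong 𝟙 (trans (cong (λ r → lookup r i) (sym (row≡code p))) (lookup-row vs u i))
      exchange : ∀ x y z → x * (y * z) ≡ y * (x * z)
      exchange = solve-∀ ℚ-ring
      third : ∀ c → ψᵣ (row vs a) (row vs b) (row vs c) ≡ Σᵥ (λ i → 𝟙 (c == lookup vs i) * t i)
      third c = trans (cong₃ (row≡code pa) (row≡code pb) (row≡code (at c)))
        (trans (ψ-third (position pa) (position pb) (position (at c)))
          (Σ-cong λ i → cong (_* t i) (entry (at c) i)))
        where
        cong₃ : ∀ {r s u r′ s′ u′} → r ≡ r′ → s ≡ s′ → u ≡ u′ → ψᵣ r s u ≡ ψᵣ r′ s′ u′
        cong₃ refl refl refl = refl

    degψ-mass : degψ H (wE H) a b ≡ ½ * Σ₅ (λ v₁ v₂ v₃ v₄ v₅ →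
      mass v₁ v₂ v₃ v₄ v₅ * (𝟙 (a == v₁) * 𝟙 (b == v₂) + 𝟙 (b == v₁) * 𝟙 (a == v₂)))
    degψ-mass = begin
      Σᵥ (λ c → if edge H a b c then wE H a b c else 0ℚ)
        ≡⟨ Σ-cong (λ c → trans (if≡𝟙* (edge H a b c) (wE H a b c)) (inside c)) ⟩
      Σᵥ (λ c → ½ * Σ₅ (F c))
        ≡⟨ Σ-*ˡ ½ (λ c → Σ₅ (F c)) ⟩
      ½ * Σᵥ (λ c → Σ₅ (F c))
        ≡⟨ cong (½ *_) (Σ₅-sumList F (allFin n)) ⟨
      ½ * Σ₅ (λ v₁ v₂ v₃ v₄ v₅ → Σᵥ λ c → F c v₁ v₂ v₃ v₄ v₅)
        ≡⟨ cong (½ *_) (Σ₅-cong λ v₁ v₂ v₃ v₄ v₅ → trans (Σ-*ˡ (mass v₁ v₂ v₃ v₄ v₅) (f v₁ v₂ v₃ v₄ v₅))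
             (mass-cong v₁ v₂ v₃ v₄ v₅ (ψ-degree (v₁ ∷ v₂ ∷ v₃ ∷ v₄ ∷ v₅ ∷ [])))) ⟩
      ½ * Σ₅ (λ v₁ v₂ v₃ v₄ v₅ → mass v₁ v₂ v₃ v₄ v₅ * (𝟙 (a == v₁) * 𝟙 (b == v₂) + 𝟙 (b == v₁) * 𝟙 (a == v₂))) ∎
      where
      open ≡-Reasoning
      f : (v₁ v₂ v₃ v₄ v₅ c : Fin n) → ℚ
      f v₁ v₂ v₃ v₄ v₅ c = let vs = v₁ ∷ v₂ ∷ v₃ ∷ v₄ ∷ v₅ ∷ [] in 𝟙 (edge H a b c) * ψᵣ (row vs a) (row vs b) (row vs c)
      F : (c v₁ v₂ v₃ v₄ v₅ : Fin n) → ℚ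
      F c v₁ v₂ v₃ v₄ v₅ = mass v₁ v₂ v₃ v₄ v₅ * f v₁ v₂ v₃ v₄ v₅ c
      exchange : ∀ x y z → x * (y * z) ≡ y * (x * z)
      exchange = solve-∀ ℚ-ring
      g : (c v₁ v₂ v₃ v₄ v₅ : Fin n) → ℚ
      g c v₁ v₂ v₃ v₄ v₅ = let vs = v₁ ∷ v₂ ∷ v₃ ∷ v₄ ∷ v₅ ∷ [] in mass v₁ v₂ v₃ v₄ v₅ * ψᵣ (row vs a) (row vs b) (row vs c)
      inside : ∀ c → 𝟙 (edge H a b c) * wE H a b c ≡ ½ * Σ₅ (F c)
      inside c = trans (cong (λ s → 𝟙 (edge H a b c) * (½ * s)) (Σ₅-cong λ v₁ v₂ v₃ v₄ v₅ → wE-integrand v₁ v₂ v₃ v₄ v₅ a b c))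
        (trans (exchange (𝟙 (edge H a b c)) ½ (Σ₅ (g c)))
          (cong (½ *_) (trans (sym (Σ₅-*ˡ (𝟙 (edge H a b c)) (g c)))
            (Σ₅-cong λ v₁ v₂ v₃ v₄ v₅ → let vs = v₁ ∷ v₂ ∷ v₃ ∷ v₄ ∷ v₅ ∷ [] in
              exchange (𝟙 (edge H a b c)) (mass v₁ v₂ v₃ v₄ v₅) (ψᵣ (row vs a) (row vs b) (row vs c))))))

  Σ-mass-pinned : ∀ a b → Σ₅ (λ v₁ v₂ v₃ v₄ v₅ → mass v₁ v₂ v₃ v₄ v₅ * (𝟙 (a == v₁) * 𝟙 (b == v₂)))
    ≡ Σᵥ (λ v₃ → Σᵥ λ v₄ → Σᵥ λ v₅ → mass a b v₃ v₄ v₅)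
  Σ-mass-pinned a b = trans (Σ₅-cong λ v₁ v₂ v₃ v₄ v₅ → regroup (mass v₁ v₂ v₃ v₄ v₅) (𝟙 (a == v₁)) (𝟙 (b == v₂)))
    (Σ₅pin-correct (just (# 0) ∷ just (# 1) ∷ nothing ∷ nothing ∷ nothing ∷ []) mass)
    where
    -- The third entry merely fills up the triple: the pattern pins v₁ and v₂ to the first two.
    open Pinned (lookup (a ∷ b ∷ b ∷ []))
    regroup : ∀ m x y → m * (x * y) ≡ x * (y * (1ℚ * (1ℚ * 1ℚ))) * m
    regroup = solve-∀ ℚ-ring

-- From nonnegativity and degrees to a perfect fractional Steiner triple system

module _ {n : ℕ} (5≤n : 5 ℕ.≤ n) (H : Hypergraph3 n) (cond : MinEssCodegreeCond H) where
  private
    0<n : 0 ℕ.< n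
    0<n = ℕ.≤-trans (s≤s z≤n) 5≤n

  open Cliques H
  open Expansion H
  open Codegree H 0<n cond
  open Weights H 0<n cond
  open Totals H

  wO≥0 : ∀ x y z → edge H x y z ≡ true → 0ℚ ≤ℚ wO H x y z
  wO≥0 x y z e = Nonnegativity.wO-nonneg e

  wE≥0 : ∀ x y z → edge H x y z ≡ true → 0ℚ ≤ℚ wE H x y z
  wE≥0 x y z e with edge-distinct H x y z e
  ... | x≢y , y≢z , x≢z = subst (0ℚ ≤ℚ_) (sym (wE-orderings x≢y y≢z x≢z))
    (0≤+ (wO≥0 x y z e) (0≤+ (wO≥0 x z y (edge-swap₂₃ e)) (0≤+ (wO≥0 y x z (edge-swap₁₂ e))
      (0≤+ (wO≥0 y z x (edge-swap₂₃ (edge-swap₁₂ e))) (0≤+ (wO≥0 z x y (edge-swap₁₂ (edge-swap₂₃ e)))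
        (wO≥0 z y x (edge-swap₁₂ (edge-swap₂₃ (edge-swap₁₂ e)))))))))

  InShadow-sym : ∀ {a b} → InShadow H a b → InShadow H b a
  InShadow-sym {a} {b} (a≢b , 0<d) = (a≢b ∘ sym) , subst (0 ℕ.<_) (count-cong (edge-sym₁₂ H a b)) 0<d

  -- Each of the orders (v₁, v₂) = (a, b) and (b, a) carries total mass 1; the factor ½ in w_H
  -- averages the two.
  degψ≡1 : ∀ a b → InShadow H a b → degψ H (wE H) a b ≡ 1ℚ
  degψ≡1 a b sh = trans (degψ-mass (proj₁ sh)) (cong (½ *_)
    (trans (Σ₅-cong λ v₁ v₂ v₃ v₄ v₅ → ℚ.*-distribˡ-+ (mass v₁ v₂ v₃ v₄ v₅) (𝟙 (a == v₁) * 𝟙 (b == v₂)) (𝟙 (b == v₁) * 𝟙 (a == v₂)))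
    (trans (Σ₅-+ (λ v₁ v₂ v₃ v₄ v₅ → mass v₁ v₂ v₃ v₄ v₅ * (𝟙 (a == v₁) * 𝟙 (b == v₂))) (λ v₁ v₂ v₃ v₄ v₅ → mass v₁ v₂ v₃ v₄ v₅ * (𝟙 (b == v₁) * 𝟙 (a == v₂))))
      (cong₂ _+_ (trans (Σ-mass-pinned a b) (Σ-mass₃ sh)) (trans (Σ-mass-pinned b a) (Σ-mass₃ (InShadow-sym sh)))))))

  -- The value is one term of the degree sum of the pair a, b, whose terms are nonnegative and add
  -- up to 1.
  wE≤1 : ∀ a b c → edge H a b c ≡ true → wE H a b c ≤ℚ 1ℚ
  wE≤1 a b c e = subst₂ _≤ℚ_ (cong (λ t → if t then wE H a b c else 0ℚ) e) (degψ≡1 a b (edge⇒shadow e))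
    (Σ-term-≤ (λ c → if edge H a b c then wE H a b c else 0ℚ) (λ c → if-nonneg (edge H a b c) (wE≥0 a b c)) c)
    where
    if-nonneg : ∀ t {y} → (t ≡ true → 0ℚ ≤ℚ y) → 0ℚ ≤ℚ (if t then y else 0ℚ)
    if-nonneg false h = ℚ.≤-refl
    if-nonneg true  h = h refl

theorem3p2 : (n : ℕ) → 5 ≤ n → (H : Hypergraph3 n) → MinEssCodegreeCond H →
    (∀ x₁ x₂ x₃ → edge H x₁ x₂ x₃ ≡ true → 0ℚ ≤ℚ wO H x₁ x₂ x₃)
    × IsPerfectFracSTS H (wE H)
theorem3p2 n 5≤n H cond = wO≥0 5≤n H cond ,
  (λ a b c e → wE≥0 5≤n H cond a b c e , wE≤1 5≤n H cond a b c e) , degψ≡1 5≤n H cond
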